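{- Let $q$ be a prime power, $m\ge1$, and let $\mathcal E$ be an egg in ${\rm PG}(4m-1,q)$ with a fixed element $E_\infty$ and tangent space $E_\infty^*$ at $E_\infty$. Let $\Gamma'$ be a $3m$-dimensional subspace of ${\rm PG}(4m-1,q)$ containing $E_\infty^*$. Put $\mathcal B_{\mathcal E}=\{E\cap\Gamma': E\in\mathcal E, E\ne E_\infty\}$ (a set of points of $\Gamma'\setminus E^*_\infty$) and $\mathcal I_{\mathcal E}=\{E^*\cap E^*_\infty: E\in\mathcal E, E\ne E_\infty\}$, where $E^*$ is the tangent space at $E$. Let $\mathcal F_{\mathcal E}$ be the family of all $2m$-dimensional subspaces of $\Gamma'$ not contained in $E^*_\infty$ that contain an element of $\mathcal I_{\mathcal E}$, and assume that $\mathcal B_{\mathcal E}$ is a minimal $\mathcal F_{\mathcal E}$-blocking set. Embed $\Gamma'$ in ${\rm PG}(4m,q)$ as a $3m$-dimensional subspace meeting a hyperplane $\Sigma_\infty$ of ${\rm PG}(4m,q)$ exactly in (the image of) $E^*_\infty$. Suppose there exist a $(2m-1)$-spread $\mathcal S$ of $\Sigma_\infty$, an element $\mathbf z\in\mathcal S$ and an $(m-1)$-dimensional subspace $\mathcal V\subseteq\mathbf z$ disjoint from $E^*_\infty$ such that $\mathcal I_{\mathcal E}=\mathcal I(\mathcal V)$, where $\mathcal I(\mathcal V)=\{\langle\mathbf x,\mathcal V\rangle\cap E^*_\infty:\mathbf x\in\mathcal S\setminus\{\mathbf z\}\}$. Then the set $\mathcal B^*$ of points of $\Pi(\mathcal S)$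 consisting of all affine points of the subspaces $\langle P,\mathcal V\rangle$, $P\in\mathcal B_{\mathcal E}$, together with the point $\mathbf z$, is a unital in $\Pi(\mathcal S)$.
   Context: An egg in ${\rm PG}(4m-1,q)$ is a set $\mathcal E$ of $q^{2m}+1$ pairwise disjoint $(m-1)$-dimensional subspaces such that any three of them span a $(3m-1)$-dimensional subspace. For each $E\in\mathcal E$ there is a unique $(3m-1)$-dimensional subspace $E^*$ (the tangent space at $E$) containing $E$ and disjoint from all other elements of $\mathcal E$. A set $\mathcal B$ of points of $\Gamma'\setminus E^*_\infty$ is a minimal $\mathcal F_{\mathcal E}$-blocking set if it meets every element of $\mathcal F_{\mathcal E}$ and through every $P\in\mathcal B$ there is an element of $\mathcal F_{\mathcal E}$ meeting $\mathcal B$ only in $P$. A $(2m-1)$-spread is a set of $(2m-1)$-dimensional subspaces partitioning the points. $\Pi(\mathcal S)$ is the André/Bruck–Bose plane: points are the affine points of ${\rm PG}(4m,q)$ (not in $\Sigma_\infty$) and the elements of $\mathcal S$; lines are the $2m$-dimensional subspaces not contained in $\Sigma_\infty$ meeting $\Sigma_\infty$ in an element of $\mathcal S$, plus the line $\mathcal S$; incidence is containment; it has order $q^{2m}$. A unital in a projective plane of order $n^2$ is a set of $n^3+1$ points meeting every line in $1$ or $n+1$ points. -}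

module Defs where

open import Level using (0ℓ)
open import Data.Nat using (ℕ; zero; suc; _+_; _*_; _^_)
open import Data.Nat.Primality using (Prime)
open import Data.Fin using (Fin)
import Data.Fin as Fin
open import Data.Vec.Functional using (Vector; _∷_; _++_)
open import Data.Product using (Σ; ∃; _×_; _,_)
open import Data.Sum using (_⊎_)
open import Data.Empty using (⊥)
open import Data.Unit using (⊤)
open import Relation.Nullary using (¬_)
open import Relation.Binary.PropositionalEquality using (_≡_; _≢_)
open import Algebra.Bundles using (CommutativeRing)

IsPrimePower : ℕ → Set
IsPrimePower q = Σ ℕ λ p → Σ ℕ λ k → Prime p × q ≡ p ^ suc k

record Field : Set₁ where
  field
    commutativeRing : CommutativeRing 0ℓ 0ℓ
  open CommutativeRing commutativeRing public
    renaming (_+_ to _+F_; _*_ to _*F_)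
  field
    0≉1     : ¬ (0# ≈ 1#)
    inverse : ∀ x → ¬ (x ≈ 0#) → Σ Carrier λ y → x *F y ≈ 1#

HasOrder : Field → ℕ → Set
HasOrder F q = Σ (Fin q → Carrier) λ e →
    (∀ i j → e i ≈ e j → i ≡ j) × (∀ x → Σ (Fin q) λ i → x ≈ e i)
  where open Field F

-- Linear algebra / projective geometry over a field F.
-- PG(n-1,F) is modelled by the vector space F^n: a projective point is a
-- nonzero vector up to a nonzero scalar, and a projective subspace of
-- dimension k-1 is a vector subspace of dimension k (given by a basis).

module Geometry (F : Field) where
  open Field F

  Vec : ℕ → Set
  Vec n = Vector Carrier n

  _≋_ : ∀ {n} → Vec n → Vec n → Set
  u ≋ v = ∀ i → u i ≈ v i

  0ᵥ : ∀ {n} → Vec n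
  0ᵥ _ = 0#

  IsZero : ∀ {n} → Vec n → Set
  IsZero v = v ≋ 0ᵥ

  _+ᵥ_ : ∀ {n} → Vec n → Vec n → Vec n
  (u +ᵥ v) i = u i +F v i

  _·_ : ∀ {n} → Carrier → Vec n → Vec n
  (c · v) i = c *F v i

  lc : ∀ {n k} → (Fin k → Carrier) → (Fin k → Vec n) → Vec n
  lc {k = zero}  c b = 0ᵥ
  lc {k = suc k} c b = (c Fin.zero · b Fin.zero) +ᵥ lc (λ j → c (Fin.suc j)) (λ j → b (Fin.suc j))

  Independent : ∀ {n k} → (Fin k → Vec n) → Set
  Independent b = ∀ c → IsZero (lc c b) → ∀ j → c j ≈ 0#

  Span : ∀ {n k} → (Fin k → Vec n) → Vec n → Set
  Span b v = Σ (_ → Carrier) λ c → v ≋ lc c b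

  -- two nonzero vectors represent the same projective point
  Proportional : ∀ {n} → Vec n → Vec n → Set
  Proportional u v = Σ Carrier λ c → v ≋ (c · u)

  -- a vector subspace of F^n of dimension k (projective dimension k-1),
  -- given by a basis
  record Subspace (n k : ℕ) : Set where
    field
      basis       : Fin k → Vec n
      independent : Independent basis
  open Subspace public

  VSet : ℕ → Set₁
  VSet n = Vec n → Set

  ⟦_⟧ : ∀ {n k} → Subspace n k → VSet n
  ⟦ W ⟧ = Span (basis W)

  _⊆_ : ∀ {n} → VSet n → VSet n → Set
  A ⊆ B = ∀ v → A v → B v

  _≐_ : ∀ {n} → VSet n → VSet n → Set
  A ≐ B = A ⊆ B × B ⊆ A

  _∩_ : ∀ {n} → VSet n → VSet n → VSet n
  (A ∩ B) v = A v × B v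

  -- disjoint as projective subspaces: only the zero vector in common
  Disjoint : ∀ {n} → VSet n → VSet n → Set
  Disjoint A B = ∀ v → A v → B v → IsZero v

  HasDim : ∀ {n} → VSet n → ℕ → Set
  HasDim {n} A k = Σ (Fin k → Vec n) λ b → Independent b × (A ≐ Span b)

  ⟨_,_⟩ : ∀ {n k l} → Subspace n k → Subspace n l → VSet n
  ⟨ U , W ⟩ = Span (basis U ++ basis W)

  Matrix : ℕ → ℕ → Set
  Matrix N n = Fin N → Fin n → Carrier

  apply : ∀ {N n} → Matrix N n → Vec n → Vec N
  apply φ v = lc v (λ j i → φ i j)

  image : ∀ {N n} → Matrix N n → VSet n → VSet N
  image φ A w = Σ (Vec _) λ v → A v × (apply φ v ≋ w)

  IsEgg : (q m : ℕ) → (Fin (q ^ (2 * m) + 1) → Subspace (4 * m) m) → Set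
  IsEgg q m E =
    (∀ i j → i ≢ j → Disjoint ⟦ E i ⟧ ⟦ E j ⟧) ×
    (∀ i j k → i ≢ j → i ≢ k → j ≢ k →
       HasDim (Span (basis (E i) ++ basis (E j) ++ basis (E k))) (3 * m))

  -- T i is the tangent space at E i: a (3m-1)-dim subspace containing E i
  -- and disjoint from every other element of the egg (it is unique)
  IsTangentFamily : (q m : ℕ) → (Fin (q ^ (2 * m) + 1) → Subspace (4 * m) m) →
                    (Fin (q ^ (2 * m) + 1) → Subspace (4 * m) (3 * m)) → Set
  IsTangentFamily q m E T =
    ∀ i → (⟦ E i ⟧ ⊆ ⟦ T i ⟧) × (∀ j → j ≢ i → Disjoint ⟦ T i ⟧ ⟦ E j ⟧)

  module EggSetup (q m : ℕ)
                  (E : Fin (q ^ (2 * m) + 1) → Subspace (4 * m) m)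
                  (T : Fin (q ^ (2 * m) + 1) → Subspace (4 * m) (3 * m))
                  (∞ : Fin (q ^ (2 * m) + 1))
                  (Γ : Subspace (4 * m) (3 * m + 1)) where

    -- B_E = { E ∩ Γ' : E ∈ 𝓔, E ≠ E∞ }  (as a set of projective points,
    -- i.e. nonzero vectors)
    B-E : VSet (4 * m)
    B-E P = ¬ IsZero P × Σ _ λ i → (i ≢ ∞) × ⟦ E i ⟧ P × ⟦ Γ ⟧ P

    I-E : Fin (q ^ (2 * m) + 1) → VSet (4 * m)
    I-E i = ⟦ T i ⟧ ∩ ⟦ T ∞ ⟧

    F-E : Subspace (4 * m) (2 * m + 1) → Set
    F-E U = (⟦ U ⟧ ⊆ ⟦ Γ ⟧) × ¬ (⟦ U ⟧ ⊆ ⟦ T ∞ ⟧) ×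
            Σ _ λ i → (i ≢ ∞) × (I-E i ⊆ ⟦ U ⟧)

    MinimalBlocking : Set
    MinimalBlocking =
      (∀ U → F-E U → Σ (Vec (4 * m)) λ P → B-E P × ⟦ U ⟧ P) ×
      (∀ P → B-E P → Σ (Subspace (4 * m) (2 * m + 1)) λ U → F-E U ×
         (∀ Q → B-E Q → ⟦ U ⟧ Q → Proportional P Q))

  -- The André/Bruck–Bose plane Π(S) in PG(4m,q) = F^{4m+1}

  IsSpread : ∀ {N k l M} → Subspace N k → (Fin M → Subspace N l) → Set
  IsSpread Σ∞ S =
    (∀ j → ⟦ S j ⟧ ⊆ ⟦ Σ∞ ⟧) ×
    (∀ j j' → j ≢ j' → Disjoint ⟦ S j ⟧ ⟦ S j' ⟧) ×
    (∀ v → ⟦ Σ∞ ⟧ v → Σ _ λ j → ⟦ S j ⟧ v)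

  module Plane (m M : ℕ) (Σ∞ : Subspace (4 * m + 1) (4 * m))
               (S : Fin M → Subspace (4 * m + 1) (2 * m)) where

    -- candidate points: affine points (vectors) and elements of S
    data Point : Set where
      aff : Vec (4 * m + 1) → Point
      inf : Fin M → Point

    IsPoint : Point → Set
    IsPoint (aff v) = ¬ IsZero v × ¬ ⟦ Σ∞ ⟧ v
    IsPoint (inf j) = ⊤

    _≈ₚ_ : Point → Point → Set
    aff u ≈ₚ aff v = Proportional u v
    aff u ≈ₚ inf j = ⊥
    inf i ≈ₚ aff v = ⊥
    inf i ≈ₚ inf j = i ≡ j

    data Line : Set where
      ord    : Subspace (4 * m + 1) (2 * m + 1) → Line
      lineS  : Line

    IsLine : Line → Set
    IsLine (ord L) = ¬ (⟦ L ⟧ ⊆ ⟦ Σ∞ ⟧) × Σ _ λ j → (⟦ L ⟧ ∩ ⟦ Σ∞ ⟧) ≐ ⟦ S j ⟧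
    IsLine lineS   = ⊤

    _on_ : Point → Line → Set
    aff v on ord L = ⟦ L ⟧ v
    inf j on ord L = ⟦ S j ⟧ ⊆ ⟦ L ⟧
    aff v on lineS = ⊥
    inf j on lineS = ⊤

    PSet : Set₁
    PSet = Point → Set

    HasSize : PSet → ℕ → Set
    HasSize A k = Σ (Fin k → Point) λ f →
      (∀ i → IsPoint (f i) × A (f i)) ×
      (∀ i j → f i ≈ₚ f j → i ≡ j) ×
      (∀ x → IsPoint x → A x → Σ (Fin k) λ i → x ≈ₚ f i)

    -- a unital of the plane Π(S), whose order is n^2
    IsUnital : ℕ → PSet → Set
    IsUnital n U =
      (∀ x → U x → IsPoint x) ×
      HasSize U (n ^ 3 + 1) ×
      (∀ L → IsLine L →
         HasSize (λ x → U x × (x on L)) 1 ⊎ HasSize (λ x → U x × (x on L)) (n + 1))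

    B* : VSet (4 * m) → Matrix (4 * m + 1) (4 * m) → Subspace (4 * m + 1) m → Fin M → PSet
    B* B φ V z (aff v) = ¬ IsZero v × ¬ ⟦ Σ∞ ⟧ v ×
                         Σ (Vec (4 * m)) λ P → B P × Span (apply φ P ∷ basis V) v
    B* B φ V z (inf j) = j ≡ z

{-# OPTIONS --safe #-}

-- The affine points of B* are normalised to α = φ P + w in a fixed translate of Σ∞, with P = E ∩ Γ' and
-- w ∈ V; there are n³ of them, n = q^m. Since the tangent space E* meets no other egg element, the x with
-- E* ∩ E∞* = ⟨x, V⟩ ∩ E∞* gives a line through α that meets B* only in α, while the line at infinity
-- is tangent at z. By the variance argument of Bruen and Thas, n³ + 1 points of a plane of order n² with
-- a tangent at each of them form a unital: counting incidences and joined pairs shows that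
-- Σ (|ℓ ∩ B*| − (n + 1))² vanishes over the lines ℓ other than the chosen tangents.
module Submission where

open import Defs
open import Data.Nat using (ℕ; zero; suc; _+_; _*_; _^_; _≤_; ∣_-_∣; z≤n; s≤s)
import Data.Nat.Properties as ℕₚ
open import Data.Nat.Tactic.RingSolver using (solve-∀)
open import Data.Fin using (Fin; zero; suc; punchIn; punchOut; funToFin; finToFun;
  combine; remQuot; _↑ˡ_; _↑ʳ_; splitAt; join)
import Data.Fin.Properties as Finₚ
open import Data.Vec.Functional using (_∷_; _++_)
open import Data.Product using (Σ; _×_; _,_; proj₁; proj₂)
open import Data.Sum using (_⊎_; inj₁; inj₂; [_,_])
open import Data.Unit using (tt)
open import Relation.Nullary using (Dec; yes; no; ¬_; contradiction)
open import Relation.Nullary.Decidable using (map′; decidable-stable)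
import Relation.Binary.PropositionalEquality as ≡
open import Relation.Binary.PropositionalEquality using (_≡_; _≢_; _≗_)
open import Function using (_∘_; id)

-- The variance count leaves no slack. With `N = n²` and `K = n³`, the squared deviations over all
-- lines except the one at infinity add up to exactly n⁵; n³ tangents, each deviating by n, already
-- contribute n³ · n² to it. The point `z` is left out of all sizes, so lines through `z` are
-- compared with n instead of n + 1, and only affine points have to be joined in pairs. The count
-- needs n² + 1 parallel classes of n² lines each, but the spread comes with an unspecified number
-- `M` of elements. Its size is recovered by cutting it with a coset of `S z`, and the lines of a
-- class become the cosets of one spread element in Σ∞. Dimension arguments are counting arguments
-- too: vectors over the finite field are coded by numbers below `q ^ k`, and an injective self-map
-- of a finite set is onto.

-- Finite sums and the variance count, in natural numbers without subtraction.

module Counting where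
  open import Data.Nat.Properties
  open import Relation.Binary.PropositionalEquality
  open import Algebra.Properties.Semiring.Sum +-*-semiring
    using (sum; sum-cong-≗; sum-remove; sum-replicate-zero; ∑-distrib-+; ∑-comm; *-distribˡ-sum; *-distribʳ-sum)

  𝟙 : {P : Set} → Dec P → ℕ
  𝟙 (yes _) = 1
  𝟙 (no _)  = 0

  𝟙-yes : {P : Set} (d : Dec P) → P → 𝟙 d ≡ 1
  𝟙-yes (yes _) _ = refl
  𝟙-yes (no ¬p) p = contradiction p ¬p

  𝟙-no : {P : Set} (d : Dec P) → ¬ P → 𝟙 d ≡ 0
  𝟙-no (yes p) ¬p = contradiction p ¬p
  𝟙-no (no _)  _  = refl

  count : ∀ {n} {P : Fin n → Set} → (∀ i → Dec (P i)) → ℕ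
  count P? = sum (λ i → 𝟙 (P? i))

  sum-const : ∀ n c → sum {n} (λ _ → c) ≡ n * c
  sum-const zero    c = refl
  sum-const (suc n) c = cong (c +_) (sum-const n c)

  sum-single : ∀ {n} (f : Fin n → ℕ) i → (∀ j → j ≢ i → f j ≡ 0) → sum f ≡ f i
  sum-single {suc n} f i f≡0 = begin
    sum f                            ≡⟨ sum-remove {i = i} f ⟩
    f i + sum (λ j → f (punchIn i j)) ≡⟨ cong (f i +_) (sum-cong-≗ λ j → f≡0 _ (Finₚ.punchInᵢ≢i i j)) ⟩
    f i + sum {n} (λ _ → 0)           ≡⟨ cong (f i +_) (sum-replicate-zero n) ⟩
    f i + 0                          ≡⟨ +-identityʳ _ ⟩
    f i                              ∎
    where open ≡-Reasoning

  term≤sum : ∀ {n} (f : Fin n → ℕ) i → f i ≤ sum f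
  term≤sum {suc n} f i = subst (f i ≤_) (sym (sum-remove {i = i} f)) (m≤m+n (f i) _)

  sum≡0⇒term≡0 : ∀ {m} (f : Fin m → ℕ) → sum f ≡ 0 → ∀ i → f i ≡ 0
  sum≡0⇒term≡0 f eq i = n≤0⇒n≡0 (≤-trans (term≤sum f i) (≤-reflexive eq))

  sum-mono-≤ : ∀ {n} {f g : Fin n → ℕ} → (∀ i → f i ≤ g i) → sum f ≤ sum g
  sum-mono-≤ {zero}  f≤g = z≤n
  sum-mono-≤ {suc n} f≤g = +-mono-≤ (f≤g zero) (sum-mono-≤ (f≤g ∘ suc))

  -- The passage from lines to incident points: a sum over lines weighted by their sizes is a sum
  -- over points. Taking `f` to be the size itself turns a sum of squares into a count of ordered
  -- pairs.
  sum-fibres : ∀ {K N} (κ : Fin K → Fin N) (f : Fin N → ℕ) →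
    sum (λ c → count (λ p → κ p Finₚ.≟ c) * f c) ≡ sum (f ∘ κ)
  sum-fibres κ f = begin
    sum (λ c → count (λ p → κ p Finₚ.≟ c) * f c)
      ≡⟨ sum-cong-≗ (λ c → *-distribʳ-sum (f c) (λ p → 𝟙 (κ p Finₚ.≟ c))) ⟩
    sum (λ c → sum (λ p → 𝟙 (κ p Finₚ.≟ c) * f c))
      ≡⟨ ∑-comm (λ c p → 𝟙 (κ p Finₚ.≟ c) * f c) ⟩
    sum (λ p → sum (λ c → 𝟙 (κ p Finₚ.≟ c) * f c))
      ≡⟨ sum-cong-≗ (λ p → trans
           (sum-single (λ c → 𝟙 (κ p Finₚ.≟ c) * f c) (κ p)
              (λ c c≢ → cong (_* f c) (𝟙-no (κ p Finₚ.≟ c) (c≢ ∘ sym))))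
           (trans (cong (_* f (κ p)) (𝟙-yes (κ p Finₚ.≟ κ p) refl)) (*-identityˡ _))) ⟩
    sum (f ∘ κ) ∎
    where open ≡-Reasoning

  sum-linear : ∀ {n} (f g h k : Fin n → ℕ) a b e →
    (∀ i → f i + a * g i + b * h i ≡ k i + e) →
    sum f + a * sum g + b * sum h ≡ sum k + n * e
  sum-linear {n} f g h k a b e eq = begin
    sum f + a * sum g + b * sum h
      ≡⟨ cong₂ (λ x y → sum f + x + y) (*-distribˡ-sum a g) (*-distribˡ-sum b h) ⟩
    sum f + sum (λ i → a * g i) + sum (λ i → b * h i)
      ≡⟨ cong (_+ sum (λ i → b * h i)) (∑-distrib-+ f (λ i → a * g i)) ⟨
    sum (λ i → f i + a * g i) + sum (λ i → b * h i)
      ≡⟨ ∑-distrib-+ (λ i → f i + a * g i) (λ i → b * h i) ⟨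
    sum (λ i → f i + a * g i + b * h i)
      ≡⟨ sum-cong-≗ eq ⟩
    sum (λ i → k i + e)
      ≡⟨ ∑-distrib-+ k (λ _ → e) ⟩
    sum k + sum {n} (λ _ → e)
      ≡⟨ cong (sum k +_) (sum-const n e) ⟩
    sum k + n * e ∎
    where open ≡-Reasoning

  sqDist : ℕ → ℕ → ℕ
  sqDist s t = ∣ s - t ∣ * ∣ s - t ∣

  -- The binomial formula with its negative term moved to the left. The distance is unchanged when
  -- both arguments drop by one, hence the double induction.
  sqDist-expand : ∀ s t → sqDist s t + 2 * t * s ≡ s * s + t * t
  sqDist-expand zero    t       = lemma t where
    lemma : ∀ t → t * t + 2 * t * 0 ≡ 0 * 0 + t * t
    lemma = solve-∀
  sqDist-expand (suc s) zero    = lemma s where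
    lemma : ∀ s → suc s * suc s + 2 * 0 * suc s ≡ suc s * suc s + 0 * 0
    lemma = solve-∀
  sqDist-expand (suc s) (suc t) = begin
    sqDist s t + 2 * suc t * suc s             ≡⟨ lemma₁ (sqDist s t) s t ⟩
    (sqDist s t + 2 * t * s) + (2 * (s + t) + 2) ≡⟨ cong (_+ (2 * (s + t) + 2)) (sqDist-expand s t) ⟩
    (s * s + t * t) + (2 * (s + t) + 2)        ≡⟨ lemma₂ s t ⟩
    suc s * suc s + suc t * suc t              ∎
    where
    open ≡-Reasoning
    lemma₁ : ∀ d s t → d + 2 * suc t * suc s ≡ (d + 2 * t * s) + (2 * (s + t) + 2)
    lemma₁ = solve-∀
    lemma₂ : ∀ s t → (s * s + t * t) + (2 * (s + t) + 2) ≡ suc s * suc s + suc t * suc t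
    lemma₂ = solve-∀

  sqDist≡0⇒≡ : ∀ s t → sqDist s t ≡ 0 → s ≡ t
  sqDist≡0⇒≡ s t eq with m*n≡0⇒m≡0∨n≡0 ∣ s - t ∣ eq
  ... | inj₁ d≡0 = ∣m-n∣≡0⇒m≡n d≡0
  ... | inj₂ d≡0 = ∣m-n∣≡0⇒m≡n d≡0

  -- `H` and `D` are the deviations of the lines off and on `z`, with tangents discarded in `H`;
  -- `T′` is the surplus of tangents over `K`; `Q` and `Q₀` are the sums of squared sizes. The first
  -- two equations expand the squares and the third counts joined pairs. At `N = n²`, `K = n³`
  -- everything but the three nonnegative terms cancels, and `X` is the amount cancelled.
  balance : ∀ n N K H T′ D Q Q₀ → N ≡ n * n → K ≡ n * (n * n) →
    H + n * n * (K + T′) + 2 * suc n * (N * K) ≡ Q + N * (N * (suc n * suc n)) →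
    D + 2 * n * K ≡ Q₀ + N * (n * n) →
    Q₀ + Q ≡ K * (K + N) →
    H + D + n * n * T′ ≡ 0
  balance n _ _ H T′ D Q Q₀ refl refl e₁ e₂ e₃ = +-cancelʳ-≡ X _ 0 (begin
    H + D + n * n * T′ + X   ≡⟨ lemma₁ n H T′ D ⟩
    (H + n * n * (K + T′) + 2 * suc n * (N * K)) + (D + 2 * n * K)
      ≡⟨ cong₂ _+_ e₁ e₂ ⟩
    (Q + N * (N * (suc n * suc n))) + (Q₀ + N * (n * n)) ≡⟨ lemma₂ Q Q₀ _ _ ⟩
    (Q₀ + Q) + (N * (N * (suc n * suc n)) + N * (n * n)) ≡⟨ cong (_+ (N * (N * (suc n * suc n)) + N * (n * n))) e₃ ⟩
    K * (K + N) + (N * (N * (suc n * suc n)) + N * (n * n)) ≡⟨ lemma₃ n ⟩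
    X ∎)
    where
    open ≡-Reasoning
    N = n * n
    K = n * (n * n)
    X = n * n * K + 2 * suc n * (N * K) + 2 * n * K
    lemma₁ : ∀ n H T′ D →
      H + D + n * n * T′ + (n * n * (n * (n * n)) + 2 * suc n * (n * n * (n * (n * n))) + 2 * n * (n * (n * n)))
      ≡ (H + n * n * (n * (n * n) + T′) + 2 * suc n * (n * n * (n * (n * n)))) + (D + 2 * n * (n * (n * n)))
    lemma₁ = solve-∀
    lemma₂ : ∀ a b c d → (a + c) + (b + d) ≡ (b + a) + (c + d)
    lemma₂ = solve-∀
    lemma₃ : ∀ n → n * (n * n) * (n * (n * n) + n * n) + (n * n * (n * n * (suc n * suc n)) + n * n * (n * n))
      ≡ n * n * (n * (n * n)) + 2 * suc n * (n * n * (n * (n * n))) + 2 * n * (n * (n * n))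
    lemma₃ = solve-∀

  -- κ j p is the line of the parallel class j through p; the lines of class zero are those through z,
  -- and their sizes do not count z itself.
  module BruenThas
    {n N K : ℕ} (N≡n² : N ≡ n * n) (K≡n³ : K ≡ n * (n * n))
    (κ : Fin (suc N) → Fin K → Fin N)
    (joined : ∀ p r → p ≢ r →
       Σ (Fin (suc N)) λ j → κ j p ≡ κ j r × (∀ j′ → κ j′ p ≡ κ j′ r → j′ ≡ j))
    (tangent : ∀ p → Σ (Fin N) λ x → ∀ r → κ (suc x) r ≡ κ (suc x) p → r ≡ p)
    where

    size : Fin (suc N) → Fin N → ℕ
    size j c = count (λ p → κ j p Finₚ.≟ c)

    ∑size : ∀ j → sum (size j) ≡ K
    ∑size j = begin
      sum (size j)               ≡⟨ sum-cong-≗ (λ c → sym (*-identityʳ (size j c))) ⟩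
      sum (λ c → size j c * 1)   ≡⟨ sum-fibres (κ j) (λ _ → 1) ⟩
      sum {K} (λ _ → 1)          ≡⟨ sum-const K 1 ⟩
      K * 1                      ≡⟨ *-identityʳ K ⟩
      K                          ∎
      where open ≡-Reasoning

    -- Both sides count triples of a class and two points on a common line of it. Distinct points
    -- share a line in one class, a point and itself in all `N + 1`, so each point accounts for
    -- `K + N` triples.
    ∑size² : sum (λ j → sum (λ c → size j c * size j c)) ≡ K * (K + N)
    ∑size² = begin
      sum (λ j → sum (λ c → size j c * size j c))
        ≡⟨ sum-cong-≗ (λ j → sum-fibres (κ j) (size j)) ⟩
      sum (λ j → sum (λ p → size j (κ j p)))
        ≡⟨ ∑-comm (λ j p → size j (κ j p)) ⟩
      sum (λ p → sum (λ j → sum (λ r → 𝟙 (κ j r Finₚ.≟ κ j p))))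
        ≡⟨ sum-cong-≗ (λ p → ∑-comm (λ j r → 𝟙 (κ j r Finₚ.≟ κ j p))) ⟩
      sum (λ p → sum (λ r → sum (λ j → 𝟙 (κ j r Finₚ.≟ κ j p))))
        ≡⟨ sum-cong-≗ {K} (λ p → sum-cong-≗ {K} (joining p)) ⟩
      sum {K} (λ p → sum (λ r → 1 + N * 𝟙 (r Finₚ.≟ p)))
        ≡⟨ sum-cong-≗ {K} perPoint ⟩
      sum {K} (λ p → K + N)
        ≡⟨ sum-const K (K + N) ⟩
      K * (K + N) ∎
      where
      open ≡-Reasoning
      joining : ∀ p r → sum (λ j → 𝟙 (κ j r Finₚ.≟ κ j p)) ≡ 1 + N * 𝟙 (r Finₚ.≟ p)
      joining p r with r Finₚ.≟ p
      ... | yes refl = trans (sum-cong-≗ (λ j → 𝟙-yes (κ j r Finₚ.≟ κ j r) refl)) (sum-const (suc N) 1)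
      ... | no r≢p with joined r p r≢p
      ...   | j , eq , unique = trans
                (sum-single _ j (λ j′ j′≢j → 𝟙-no (κ j′ r Finₚ.≟ κ j′ p) (j′≢j ∘ unique j′)))
                (trans (𝟙-yes (κ j r Finₚ.≟ κ j p) eq) (cong suc (sym (*-zeroʳ N))))
      perPoint : ∀ p → sum (λ r → 1 + N * 𝟙 (r Finₚ.≟ p)) ≡ K + N
      perPoint p = begin
        sum (λ r → 1 + N * 𝟙 (r Finₚ.≟ p))
          ≡⟨ ∑-distrib-+ {K} (λ _ → 1) (λ r → N * 𝟙 (r Finₚ.≟ p)) ⟩
        sum {K} (λ _ → 1) + sum (λ r → N * 𝟙 (r Finₚ.≟ p))
          ≡⟨ cong₂ _+_ (trans (sum-const K 1) (*-identityʳ K))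
               (trans (sum-single (λ r → N * 𝟙 (r Finₚ.≟ p)) p (λ r r≢p → trans (cong (N *_) (𝟙-no (r Finₚ.≟ p) r≢p)) (*-zeroʳ N)))
                 (trans (cong (N *_) (𝟙-yes (p Finₚ.≟ p) refl)) (*-identityʳ N))) ⟩
        K + N ∎

    τ : ℕ → ℕ
    τ s = 𝟙 (s ≟ 1)

    -- Incident pairs of a point and a tangent are counted twice: every point lies on at least one,
    -- and a line of size 1 carries only one point, which is `s * τ s ≡ τ s`.
    K≤∑τ : K ≤ sum (λ x → sum (λ c → τ (size (suc x) c)))
    K≤∑τ = begin
      K ≡⟨ *-identityʳ K ⟨
      K * 1 ≡⟨ sum-const K 1 ⟨
      sum {K} (λ _ → 1) ≤⟨ sum-mono-≤ tangentAt ⟩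
      sum (λ p → sum (λ x → τ (size (suc x) (κ (suc x) p))))
        ≡⟨ ∑-comm (λ x p → τ (size (suc x) (κ (suc x) p))) ⟨
      sum (λ x → sum (λ p → τ (size (suc x) (κ (suc x) p))))
        ≡⟨ sum-cong-≗ (λ x → sum-fibres (κ (suc x)) (τ ∘ size (suc x))) ⟨
      sum (λ x → sum (λ c → size (suc x) c * τ (size (suc x) c)))
        ≡⟨ sum-cong-≗ (λ x → sum-cong-≗ (λ c → s*τ (size (suc x) c))) ⟩
      sum (λ x → sum (λ c → τ (size (suc x) c))) ∎
      where
      open ≤-Reasoning
      s*τ : ∀ s → s * τ s ≡ τ s
      s*τ s with s ≟ 1
      ... | yes refl = refl
      ... | no _     = *-zeroʳ s
      tangentAt : ∀ p → 1 ≤ sum (λ x → τ (size (suc x) (κ (suc x) p)))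
      tangentAt p with tangent p
      ... | x , alone = ≤-trans (≤-reflexive (sym (𝟙-yes (_ ≟ 1) size≡1)))
                          (term≤sum (λ x → τ (size (suc x) (κ (suc x) p))) x)
        where
        size≡1 : size (suc x) (κ (suc x) p) ≡ 1
        size≡1 = trans
          (sum-single _ p (λ r r≢p → 𝟙-no (κ (suc x) r Finₚ.≟ κ (suc x) p) (r≢p ∘ alone r)))
          (𝟙-yes (κ (suc x) p Finₚ.≟ κ (suc x) p) refl)

    -- A tangent contributes n² to Σ (size − (n + 1))²; excess discards that contribution.
    excess : ℕ → ℕ
    excess s with s ≟ 1
    ... | yes _ = 0
    ... | no  _ = sqDist s (suc n)

    excess-expand : ∀ s → excess s + n * n * τ s + 2 * suc n * s ≡ s * s + suc n * suc n
    excess-expand s with s ≟ 1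
    ... | yes refl = trans (cong (_+ 2 * suc n * 1) (*-identityʳ (n * n))) (sqDist-expand 1 (suc n))
    ... | no  _    = trans (cong (_+ 2 * suc n * s) (trans (cong (sqDist s (suc n) +_) (*-zeroʳ (n * n))) (+-identityʳ _)))
                       (sqDist-expand s (suc n))

    ∑excess ∑deviation : ℕ
    ∑excess    = sum (λ x → sum (λ c → excess (size (suc x) c)))
    ∑deviation = sum (λ c → sqDist (size zero c) n)

    private
      T Q Q₀ : ℕ
      T  = sum (λ x → sum (λ c → τ (size (suc x) c)))
      Q  = sum (λ x → sum (λ c → size (suc x) c * size (suc x) c))
      Q₀ = sum (λ c → size zero c * size zero c)

      sizes : ∑excess + n * n * T + 2 * suc n * (N * K) ≡ Q + N * (N * (suc n * suc n))
      sizes = trans (cong (λ y → ∑excess + n * n * T + 2 * suc n * y) (sym (sum-const N K)))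
        (sum-linear
          (λ x → sum (λ c → excess (size (suc x) c)))
          (λ x → sum (λ c → τ (size (suc x) c)))
          (λ _ → K)
          (λ x → sum (λ c → size (suc x) c * size (suc x) c))
          (n * n) (2 * suc n) (N * (suc n * suc n))
          (λ x → trans
            (cong (λ y → sum (λ c → excess (size (suc x) c)) + n * n * sum (λ c → τ (size (suc x) c)) + 2 * suc n * y)
              (sym (∑size (suc x))))
            (sum-linear _ (λ c → τ (size (suc x) c)) (size (suc x)) _ (n * n) (2 * suc n) (suc n * suc n)
              (λ c → excess-expand (size (suc x) c)))))

      sizes₀ : ∑deviation + 2 * n * K ≡ Q₀ + N * (n * n)
      sizes₀ = trans
        (cong₂ (λ x y → x + 2 * n * y) (sym (+-identityʳ _)) (sym (∑size zero)))
        (sum-linear _ (λ _ → 0) (size zero) _ 0 (2 * n) (n * n)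
          (λ c → trans (cong (_+ 2 * n * size zero c) (+-identityʳ _)) (sqDist-expand (size zero c) n)))

      ∑≡0 : ∑excess + ∑deviation ≡ 0
      -- The number of tangents is written as `K + T′`, since only a lower bound is known before the
      -- count is closed.
      ∑≡0 with m≤n⇒∃[o]m+o≡n K≤∑τ
      ... | T′ , K+T′≡T = m+n≡0⇒m≡0 _ (balance n N K ∑excess T′ ∑deviation Q Q₀ N≡n² K≡n³
              (trans (cong (λ t → ∑excess + n * n * t + 2 * suc n * (N * K)) K+T′≡T) sizes) sizes₀ ∑size²)

    size-zero : ∀ c → size zero c ≡ n
    size-zero c = sqDist≡0⇒≡ _ _ (sum≡0⇒term≡0 (λ c → sqDist (size zero c) n) (m+n≡0⇒n≡0 ∑excess ∑≡0) c)

    size-suc : ∀ x c → size (suc x) c ≡ 1 ⊎ size (suc x) c ≡ suc n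
    size-suc x c = excess≡0 _ (sum≡0⇒term≡0 (λ c → excess (size (suc x) c))
      (sum≡0⇒term≡0 (λ x → sum (λ c → excess (size (suc x) c))) (m+n≡0⇒m≡0 ∑excess ∑≡0) x) c)
      where
      excess≡0 : ∀ s → excess s ≡ 0 → s ≡ 1 ⊎ s ≡ suc n
      excess≡0 s eq with s ≟ 1
      ... | yes s≡1 = inj₁ s≡1
      ... | no  _   = inj₂ (sqDist≡0⇒≡ s (suc n) eq)

open Counting

-- Finite sets: pigeonhole principle and enumeration of decidable subsets.

injective⇒surjective : ∀ {n} (f : Fin n → Fin n) → (∀ i j → f i ≡ f j → i ≡ j) →
                       ∀ y → Σ (Fin n) λ x → f x ≡ y
injective⇒surjective {suc n} f inj y with Finₚ.any? (λ x → f x Finₚ.≟ y)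
... | yes hit = hit
... | no miss = contradiction
        (Finₚ.injective⇒≤ {f = λ x → punchOut (avoid x)}
          (λ {i} {j} eq → inj i j (Finₚ.punchOut-injective (avoid i) (avoid j) eq)))
        ℕₚ.1+n≰n
  where
  avoid : ∀ x → y ≢ f x
  avoid x y≡fx = miss (x , ≡.sym y≡fx)

funToFin-cong : ∀ {m n} {f g : Fin m → Fin n} → f ≗ g → funToFin f ≡ funToFin g
funToFin-cong {zero}  f≗g = ≡.refl
funToFin-cong {suc m} f≗g = ≡.cong₂ combine (f≗g zero) (funToFin-cong (f≗g ∘ suc))

Enumeration : ∀ {n} → (Fin n → Set) → ℕ → Set
Enumeration {n} P k = Σ (Fin k → Fin n) λ f →
  (∀ i → P (f i)) × (∀ i j → f i ≡ f j → i ≡ j) × (∀ p → P p → Σ (Fin k) λ i → f i ≡ p)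

enumerate : ∀ {n} {P : Fin n → Set} (P? : ∀ i → Dec (P i)) → Enumeration P (count P?)
enumerate {zero}  P? = (λ ()) , (λ ()) , (λ ()) , (λ ())
enumerate {suc n} {P} P? = extend (P? zero) (enumerate (P? ∘ suc))
  where
  extend : ∀ {k} (d : Dec (P zero)) → Enumeration (P ∘ suc) k → Enumeration P (𝟙 d + k)
  extend (yes p) (f , sound , inj , complete) = f′ , sound′ , inj′ , complete′
    where
    f′ : Fin (suc _) → Fin (suc n)
    f′ zero    = zero
    f′ (suc i) = suc (f i)
    sound′ : ∀ i → P (f′ i)
    sound′ zero    = p
    sound′ (suc i) = sound i
    inj′ : ∀ i j → f′ i ≡ f′ j → i ≡ j
    inj′ zero    zero    _  = ≡.refl
    inj′ zero    (suc j) ()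
    inj′ (suc i) zero    ()
    inj′ (suc i) (suc j) eq = ≡.cong suc (inj i j (Finₚ.suc-injective eq))
    complete′ : ∀ p → P p → Σ _ λ i → f′ i ≡ p
    complete′ zero    _  = zero , ≡.refl
    complete′ (suc r) Pr = let i , eq = complete r Pr in suc i , ≡.cong suc eq
  extend (no ¬p) (f , sound , inj , complete) =
    suc ∘ f , sound , (λ i j eq → inj i j (Finₚ.suc-injective eq)) ,
    λ { zero Pz → contradiction Pz ¬p
      ; (suc r) Pr → let i , eq = complete r Pr in i , ≡.cong suc eq }

-- The bound `L` is a variable because the egg is indexed by `Fin (N + 1)`, which does not compute
-- to a successor.
allBut : ∀ {L N} → L ≡ suc N → (i : Fin L) → Enumeration (_≢ i) N
allBut ≡.refl i = punchIn i , Finₚ.punchInᵢ≢i i , Finₚ.punchIn-injective i ,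
  λ j j≢i → punchOut (j≢i ∘ ≡.sym) , Finₚ.punchIn-punchOut (j≢i ∘ ≡.sym)

-- Linear combinations, spans and sums of subspaces.

module LinearAlgebra (F : Field) where
  open Field F hiding (zero)
  open Geometry F
  open import Algebra.Properties.CommutativeSemigroup +-commutativeSemigroup using (interchange)
  open import Algebra.Properties.Ring ring using (-1*x≈-x)
  open import Algebra.Properties.AbelianGroup +-abelianGroup
    using (⁻¹-∙-comm; x∙y⁻¹≈ε⇒x≈y; x≈y⇒x∙y⁻¹≈ε)
  import Relation.Binary.Reasoning.Setoid setoid as ≈R

  infixl 6 _-ᵥ_
  _-ᵥ_ : ∀ {n} → Vec n → Vec n → Vec n
  (u -ᵥ v) i = u i - v i

  ≋-sym : ∀ {n} {u v : Vec n} → u ≋ v → v ≋ u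
  ≋-sym u≋v i = sym (u≋v i)

  ≋-trans : ∀ {n} {u v w : Vec n} → u ≋ v → v ≋ w → u ≋ w
  ≋-trans u≋v v≋w i = trans (u≋v i) (v≋w i)

  lc-cong : ∀ {n k} {c d : Fin k → Carrier} {b e : Fin k → Vec n} →
            (∀ j → c j ≈ d j) → (∀ j → b j ≋ e j) → lc c b ≋ lc d e
  lc-cong {k = zero}  c≈d b≋e i = refl
  lc-cong {k = suc k} c≈d b≋e i =
    +-cong (*-cong (c≈d zero) (b≋e zero i)) (lc-cong (c≈d ∘ suc) (b≋e ∘ suc) i)

  lc-congˡ : ∀ {n k} {c d : Fin k → Carrier} (b : Fin k → Vec n) →
             (∀ j → c j ≈ d j) → lc c b ≋ lc d b
  lc-congˡ b c≈d = lc-cong c≈d (λ _ _ → refl)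

  lc-0 : ∀ {n k} (b : Fin k → Vec n) → lc (λ _ → 0#) b ≋ 0ᵥ
  lc-0 {k = zero}  b i = refl
  lc-0 {k = suc k} b i = trans (+-cong (zeroˡ _) (lc-0 (b ∘ suc) i)) (+-identityˡ _)

  lc-+ : ∀ {n k} (c d : Fin k → Carrier) (b : Fin k → Vec n) →
         lc (λ j → c j +F d j) b ≋ (lc c b +ᵥ lc d b)
  lc-+ {k = zero}  c d b i = sym (+-identityˡ _)
  lc-+ {k = suc k} c d b i = trans
    (+-cong (distribʳ _ _ _) (lc-+ (c ∘ suc) (d ∘ suc) (b ∘ suc) i))
    (interchange _ _ _ _)

  lc-* : ∀ {n k} a (c : Fin k → Carrier) (b : Fin k → Vec n) →
         lc (λ j → a *F c j) b ≋ (a · lc c b)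
  lc-* {k = zero}  a c b i = sym (zeroʳ a)
  lc-* {k = suc k} a c b i = trans
    (+-cong (*-assoc _ _ _) (lc-* a (c ∘ suc) (b ∘ suc) i))
    (sym (distribˡ _ _ _))

  lc-‿- : ∀ {n k} (c d : Fin k → Carrier) (b : Fin k → Vec n) →
         lc (λ j → c j - d j) b ≋ (lc c b -ᵥ lc d b)
  lc-‿- c d b i = trans (lc-+ c (λ j → - d j) b i)
    (+-congˡ (trans (lc-congˡ b (λ j → sym (-1*x≈-x (d j))) i)
      (trans (lc-* (- 1#) d b i) (-1*x≈-x _))))

  lc-++ : ∀ {n k l} (c : Fin (k + l) → Carrier) (b : Fin k → Vec n) (e : Fin l → Vec n) →
          lc c (b ++ e) ≋ (lc (λ j → c (j ↑ˡ l)) b +ᵥ lc (λ j → c (k ↑ʳ j)) e)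
  lc-++ {k = zero}  c b e i = sym (+-identityˡ _)
  lc-++ {k = suc k} {l} c b e i = trans
    (+-congˡ (trans
      (lc-cong {c = c ∘ suc} {d = c ∘ suc} (λ _ → refl) tail-++ i)
      (lc-++ (c ∘ suc) (b ∘ suc) e i)))
    (sym (+-assoc _ _ _))
    where
    tail-++ : ∀ j → (b ++ e) (suc j) ≋ ((b ∘ suc) ++ e) j
    tail-++ j i with splitAt k j
    ... | inj₁ _ = refl
    ... | inj₂ _ = refl

  record IsVectorSubspace {n} (A : VSet n) : Set where
    field
      resp     : ∀ {u v} → u ≋ v → A u → A v
      0-closed : A 0ᵥ
      +-closed : ∀ {u v} → A u → A v → A (u +ᵥ v)
      ·-closed : ∀ c {v} → A v → A (c · v)

    sub-closed : ∀ {u v} → A u → A v → A (u -ᵥ v)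
    sub-closed Au Av = resp (λ i → +-congˡ (-1*x≈-x _)) (+-closed Au (·-closed (- 1#) Av))

    lc-closed : ∀ {k} c (b : Fin k → Vec n) → (∀ j → A (b j)) → A (lc c b)
    lc-closed {zero}  c b Ab = 0-closed
    lc-closed {suc k} c b Ab = +-closed (·-closed _ (Ab zero)) (lc-closed (c ∘ suc) (b ∘ suc) (Ab ∘ suc))

    Span⊆ : ∀ {k} {b : Fin k → Vec n} → (∀ j → A (b j)) → Span b ⊆ A
    Span⊆ {b = b} Ab v (c , v≋) = resp (≋-sym v≋) (lc-closed c b Ab)

  Span-isVectorSubspace : ∀ {n k} (b : Fin k → Vec n) → IsVectorSubspace (Span b)
  Span-isVectorSubspace b = record
    { resp     = λ { u≋v (c , u≋) → c , ≋-trans (≋-sym u≋v) u≋ }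
    ; 0-closed = (λ _ → 0#) , ≋-sym (lc-0 b)
    ; +-closed = λ { (c , u≋) (d , v≋) → (λ j → c j +F d j) ,
                     λ i → trans (+-cong (u≋ i) (v≋ i)) (sym (lc-+ c d b i)) }
    ; ·-closed = λ { a (c , v≋) → (λ j → a *F c j) ,
                     λ i → trans (*-congˡ (v≋ i)) (sym (lc-* a c b i)) }
    }

  unit : ∀ {n} → Fin n → Vec n
  unit zero    = 1# ∷ λ _ → 0#
  unit (suc j) = 0# ∷ unit j

  basis≋lc-unit : ∀ {n k} (b : Fin k → Vec n) j → b j ≋ lc (unit j) b
  basis≋lc-unit b zero    i = sym (trans (+-cong (*-identityˡ _) (lc-0 (b ∘ suc) i)) (+-identityʳ _))
  basis≋lc-unit b (suc j) i = sym (trans (+-cong (zeroˡ _) (sym (basis≋lc-unit (b ∘ suc) j i))) (+-identityˡ _))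

  basis∈Span : ∀ {n k} (b : Fin k → Vec n) j → Span b (b j)
  basis∈Span b j = unit j , basis≋lc-unit b j

  _⊕ˢ_ : ∀ {n} → VSet n → VSet n → VSet n
  (A ⊕ˢ B) v = Σ _ λ u → Σ _ λ w → A u × B w × v ≋ (u +ᵥ w)

  Span-++⁻ : ∀ {n k l} (b : Fin k → Vec n) (e : Fin l → Vec n) → Span (b ++ e) ⊆ (Span b ⊕ˢ Span e)
  Span-++⁻ b e v (c , v≋) = _ , _ , (_ , λ _ → refl) , (_ , λ _ → refl) , ≋-trans v≋ (lc-++ c b e)

  Span-++⁺ : ∀ {n k l} (b : Fin k → Vec n) (e : Fin l → Vec n) → (Span b ⊕ˢ Span e) ⊆ Span (b ++ e)
  Span-++⁺ {k = k} {l} b e v (u , w , (c , u≋) , (d , w≋) , v≋) = (c ++ d) , λ i → trans (v≋ i) (trans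
    (+-cong (u≋ i) (w≋ i))
    (sym (trans (lc-++ (c ++ d) b e i) (+-cong
      (lc-congˡ b (λ j → reflexive (≡.cong [ c , d ] (Finₚ.splitAt-↑ˡ k j l))) i)
      (lc-congˡ e (λ j → reflexive (≡.cong [ c , d ] (Finₚ.splitAt-↑ʳ k l j))) i)))))

  lc-unit : ∀ {n} (v : Vec n) → v ≋ lc v unit
  lc-unit {suc n} v i = sym (at i)
    where
    padded₀ : ∀ {k} (c : Fin k → Carrier) (b : Fin k → Vec n) → lc c (λ j → 0# ∷ b j) zero ≈ 0#
    padded₀ {zero}  c b = refl
    padded₀ {suc k} c b = trans (+-cong (zeroʳ _) (padded₀ (c ∘ suc) (b ∘ suc))) (+-identityˡ _)
    padded₊ : ∀ {k} (c : Fin k → Carrier) (b : Fin k → Vec n) i → lc c (λ j → 0# ∷ b j) (suc i) ≈ lc c b i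
    padded₊ {zero}  c b i = refl
    padded₊ {suc k} c b i = +-congˡ (padded₊ (c ∘ suc) (b ∘ suc) i)
    at : ∀ i → lc v unit i ≈ v i
    at zero    = trans (+-cong (*-identityʳ _) (padded₀ (v ∘ suc) unit)) (+-identityʳ _)
    at (suc i) = trans (+-cong (zeroʳ _) (trans (padded₊ (v ∘ suc) unit i) (sym (lc-unit (v ∘ suc) i)))) (+-identityˡ _)

  ≋⇒-≋0 : ∀ {n} {u v : Vec n} → u ≋ v → IsZero (u -ᵥ v)
  ≋⇒-≋0 u≋v i = x≈y⇒x∙y⁻¹≈ε (u≋v i)

  -≋0⇒≋ : ∀ {n} {u v : Vec n} → IsZero (u -ᵥ v) → u ≋ v
  -≋0⇒≋ eq i = x∙y⁻¹≈ε⇒x≈y _ _ (eq i)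

  coordinates-unique : ∀ {n k} {b : Fin k → Vec n} → Independent b →
    ∀ {c d} → lc c b ≋ lc d b → ∀ j → c j ≈ d j
  coordinates-unique {b = b} ind {c} {d} eq j =
    x∙y⁻¹≈ε⇒x≈y _ _ (ind _ (λ i → trans (lc-‿- c d b i) (≋⇒-≋0 eq i)) j)

  -- Linear algebra over a finite field, with `code` as a canonical form of coordinate vectors up to
  -- `≈`.

  module Finite {q : ℕ} (order : HasOrder F q) where
    el : Fin q → Carrier
    el = proj₁ order
    ix : Carrier → Fin q
    ix x = proj₁ (proj₂ (proj₂ order) x)
    el-ix : ∀ x → x ≈ el (ix x)
    el-ix x = proj₂ (proj₂ (proj₂ order) x)

    ix-cong : ∀ {x y} → x ≈ y → ix x ≡ ix y
    ix-cong {x} {y} x≈y = proj₁ (proj₂ order) _ _ (trans (sym (el-ix x)) (trans x≈y (el-ix y)))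

    ix-injective : ∀ {x y} → ix x ≡ ix y → x ≈ y
    ix-injective {x} {y} eq = trans (el-ix x) (trans (reflexive (≡.cong el eq)) (sym (el-ix y)))

    _≈?_ : ∀ x y → Dec (x ≈ y)
    x ≈? y = map′ ix-injective ix-cong (ix x Finₚ.≟ ix y)

    code : ∀ {k} → (Fin k → Carrier) → Fin (q ^ k)
    code c = funToFin (ix ∘ c)
    decode : ∀ {k} → Fin (q ^ k) → Fin k → Carrier
    decode x = el ∘ finToFun x

    code-cong : ∀ {k} {c d : Fin k → Carrier} → (∀ j → c j ≈ d j) → code c ≡ code d
    code-cong c≈d = funToFin-cong (λ j → ix-cong (c≈d j))

    code-injective : ∀ {k} {c d : Fin k → Carrier} → code c ≡ code d → ∀ j → c j ≈ d j
    code-injective {c = c} {d} eq j = ix-injective (≡.trans (≡.sym (Finₚ.finToFun-funToFin (ix ∘ c) j))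
      (≡.trans (≡.cong (λ x → finToFun x j) eq) (Finₚ.finToFun-funToFin (ix ∘ d) j)))

    decode-code : ∀ {k} (c : Fin k → Carrier) j → c j ≈ decode (code c) j
    decode-code c j = trans (el-ix (c j)) (reflexive (≡.cong el (≡.sym (Finₚ.finToFun-funToFin (ix ∘ c) j))))

    code-decode : ∀ {k} (x : Fin (q ^ k)) → code {k} (decode x) ≡ x
    code-decode {k} x = ≡.trans
      (funToFin-cong {k} (λ j → proj₁ (proj₂ order) _ _ (sym (el-ix (decode x j)))))
      (Finₚ.funToFin-finToFin {k} x)

    _∈Span?_ : ∀ {n k} (v : Vec n) (b : Fin k → Vec n) → Dec (Span b v)
    v ∈Span? b = map′
      (λ { (x , eq) → decode x , eq })
      (λ { (c , v≋) → code c , ≋-trans v≋ (lc-congˡ b (decode-code c)) })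
      (Finₚ.any? (λ x → Finₚ.all? (λ i → v i ≈? lc (decode x) b i)))

    -- An injective linear map between the coordinate spaces of equal finite size is onto.
    exchange : ∀ {n k} (b c : Fin k → Vec n) → Independent b → (∀ j → Span c (b j)) → Span c ⊆ Span b
    exchange {n} {k} b c ind b⊆c v (d , v≋) =
      decode x , ≋-trans v≋ (≋-trans (lc-congˡ c (λ j → sym (code-injective fx≡ j))) (≋-sym (proj₂ (coords x))))
      where
      coords : ∀ x → Span c (lc (decode x) b)
      coords x = IsVectorSubspace.lc-closed (Span-isVectorSubspace c) (decode x) b b⊆c
      f : Fin (q ^ k) → Fin (q ^ k)
      f x = code (proj₁ (coords x))
      f-injective : ∀ x y → f x ≡ f y → x ≡ y
      f-injective x y eq = ≡.trans (≡.sym (code-decode {k} x)) (≡.trans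
        (code-cong (coordinates-unique ind (≋-trans (proj₂ (coords x))
          (≋-trans (lc-congˡ c (code-injective eq)) (≋-sym (proj₂ (coords y)))))))
        (code-decode {k} y))
      hit = injective⇒surjective f f-injective (code d)
      x = proj₁ hit
      fx≡ = proj₂ hit

    -- Otherwise `exchange` makes `b ∘ suc` span all of `Span c`, so `b zero` is a combination of
    -- the other vectors; its relation with them has leading coefficient 1, against independence.
    ∃∉Span : ∀ {n k l} (b : Fin l → Vec n) (c : Fin k → Vec n) → l ≡ suc k → Independent b →
             Σ (Fin l) λ j → ¬ Span c (b j)
    ∃∉Span b c ≡.refl ind = Finₚ.¬∀⟶∃¬ _ _ (λ j → b j ∈Span? c) λ b⊆c →
      let d , b₀≋ = exchange (b ∘ suc) c tail-ind (b⊆c ∘ suc) (b zero) (b⊆c zero)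
      in 0≉1 (sym (ind (1# ∷ λ j → 0# - d j) (λ i → trans
           (+-cong (*-identityˡ _) (trans (lc-‿- (λ _ → 0#) d (b ∘ suc) i)
             (+-cong (lc-0 (b ∘ suc) i) (-‿cong (sym (b₀≋ i))))))
           (trans (+-congˡ (+-identityˡ _)) (-‿inverseʳ _))) zero))
      where
      tail-ind : Independent (b ∘ suc)
      tail-ind d eq j = ind (0# ∷ d) (λ i → trans (+-cong (zeroˡ _) (eq i)) (+-identityˡ _)) (suc j)

    -- The joint basis of two disjoint subspaces is independent and as long as `g`, so by `exchange`
    -- their sum fills `Span g`.
    module Complements {n k l d} (U : Subspace n k) (W : Subspace n l) (g : Fin d → Vec n)
      (k+l≡d : k + l ≡ d) (U⊆g : ⟦ U ⟧ ⊆ Span g) (W⊆g : ⟦ W ⟧ ⊆ Span g)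
      (disjoint : Disjoint ⟦ U ⟧ ⟦ W ⟧) where

      private
        module U = IsVectorSubspace (Span-isVectorSubspace (basis U))
        module W = IsVectorSubspace (Span-isVectorSubspace (basis W))

      cancelˡ : ∀ {u u′ w w′} → ⟦ U ⟧ (u -ᵥ u′) → ⟦ W ⟧ w → ⟦ W ⟧ w′ →
                (u +ᵥ w) ≋ (u′ +ᵥ w′) → w ≋ w′
      cancelˡ {u} {u′} {w} {w′} Uu Ww Ww′ eq = ≋-sym (-≋0⇒≋ (disjoint _
        (U.resp (λ i → swap (u i) (u′ i) (w i) (w′ i) (eq i)) Uu)
        (W.sub-closed Ww′ Ww)))
        where
        swap : ∀ u u′ w w′ → u +F w ≈ u′ +F w′ → u - u′ ≈ w′ - w
        swap u u′ w w′ eq = begin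
          u - u′                    ≈⟨ +-identityʳ _ ⟨
          (u - u′) +F 0#            ≈⟨ +-congˡ (-‿inverseʳ w) ⟨
          (u - u′) +F (w - w)       ≈⟨ interchange _ _ _ _ ⟩
          (u +F w) +F (- u′ - w)    ≈⟨ +-congʳ eq ⟩
          (u′ +F w′) +F (- u′ - w)  ≈⟨ interchange _ _ _ _ ⟩
          (u′ - u′) +F (w′ - w)     ≈⟨ +-congʳ (-‿inverseʳ u′) ⟩
          0# +F (w′ - w)            ≈⟨ +-identityˡ _ ⟩
          w′ - w                    ∎
          where open ≈R

      ++-independent : Independent (basis U ++ basis W)
      ++-independent c eq j with splitAt k j in split
      ... | r = ≡.subst (λ j → c j ≈ 0#) (≡.trans (≡.cong (join k l) (≡.sym split)) (Finₚ.join-splitAt k l j)) (zero-at r)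
        where
        cU = λ j → c (j ↑ˡ l)
        cW = λ j → c (k ↑ʳ j)
        sum≋0 : (lc cU (basis U) +ᵥ lc cW (basis W)) ≋ 0ᵥ
        sum≋0 i = trans (sym (lc-++ c (basis U) (basis W) i)) (eq i)
        W≋0 : IsZero (lc cW (basis W))
        W≋0 = cancelˡ {u′ = 0ᵥ} (U.sub-closed (cU , λ _ → refl) U.0-closed) (cW , λ _ → refl) W.0-closed
                (λ i → trans (sum≋0 i) (sym (+-identityʳ _)))
        U≋0 : IsZero (lc cU (basis U))
        U≋0 i = trans (sym (+-identityʳ _)) (trans (+-congˡ (sym (W≋0 i))) (sum≋0 i))
        zero-at : ∀ r → c (join k l r) ≈ 0#
        zero-at (inj₁ j) = independent U cU U≋0 j
        zero-at (inj₂ j) = independent W cW W≋0 j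

      decompose : Span g ⊆ (⟦ U ⟧ ⊕ˢ ⟦ W ⟧)
      decompose = go k+l≡d g in-g
        where
        in-g : ∀ j → Span g ((basis U ++ basis W) j)
        in-g j with splitAt k j
        ... | inj₁ i = U⊆g _ (basis∈Span (basis U) i)
        ... | inj₂ i = W⊆g _ (basis∈Span (basis W) i)
        go : ∀ {d} → k + l ≡ d → (g : Fin d → Vec n) → (∀ j → Span g ((basis U ++ basis W) j)) →
             Span g ⊆ (⟦ U ⟧ ⊕ˢ ⟦ W ⟧)
        go ≡.refl g in-g v v∈ = Span-++⁻ (basis U) (basis W) v
          (exchange (basis U ++ basis W) g ++-independent in-g v v∈)

      module _ {I : Set} (p : I → Vec n) (p∈g : ∀ i → Span g (p i)) where
        private
          parts : ∀ i → (⟦ U ⟧ ⊕ˢ ⟦ W ⟧) (p i)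
          parts i = decompose (p i) (p∈g i)
          uPart wPart : I → Vec n
          uPart i = proj₁ (parts i)
          wPart i = proj₁ (proj₂ (parts i))
          uPart∈ : ∀ i → ⟦ U ⟧ (uPart i)
          uPart∈ i = proj₁ (proj₂ (proj₂ (parts i)))
          wPart∈ : ∀ i → ⟦ W ⟧ (wPart i)
          wPart∈ i = proj₁ (proj₂ (proj₂ (proj₂ (parts i))))
          p≋ : ∀ i → p i ≋ (uPart i +ᵥ wPart i)
          p≋ i = proj₂ (proj₂ (proj₂ (proj₂ (parts i))))

        -- The component in `W` depends only on the coset modulo `U`, so its coordinates name the
        -- coset.
        cosetLabel : I → Fin (q ^ l)
        cosetLabel i = code (proj₁ (wPart∈ i))

        label≡⇒coset : ∀ i j → cosetLabel i ≡ cosetLabel j → ⟦ U ⟧ (p i -ᵥ p j)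
        label≡⇒coset i j eq = U.resp (λ t → sym (begin
          p i t - p j t
            ≈⟨ +-cong (p≋ i t) (-‿cong (p≋ j t)) ⟩
          (uPart i t +F wPart i t) - (uPart j t +F wPart j t)
            ≈⟨ +-congˡ (⁻¹-∙-comm _ _) ⟨
          (uPart i t +F wPart i t) +F (- uPart j t - wPart j t)
            ≈⟨ interchange _ _ _ _ ⟩
          (uPart i t - uPart j t) +F (wPart i t - wPart j t)
            ≈⟨ +-congˡ (≋⇒-≋0 w≋w t) ⟩
          (uPart i t - uPart j t) +F 0#
            ≈⟨ +-identityʳ _ ⟩
          uPart i t - uPart j t ∎))
          (U.sub-closed (uPart∈ i) (uPart∈ j))
          where
          open ≈R
          w≋w : wPart i ≋ wPart j
          w≋w = ≋-trans (proj₂ (wPart∈ i)) (≋-trans (lc-congˡ (basis W) (code-injective eq)) (≋-sym (proj₂ (wPart∈ j))))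

        coset⇒label≡ : ∀ i j → ⟦ U ⟧ (p i -ᵥ p j) → cosetLabel i ≡ cosetLabel j
        coset⇒label≡ i j Up = code-cong (coordinates-unique (independent W)
          (≋-trans (≋-sym (proj₂ (wPart∈ i))) (≋-trans w≋w (proj₂ (wPart∈ j)))))
          where
          Δ : Vec n
          Δ = p i -ᵥ p j
          w≋w : wPart i ≋ wPart j
          w≋w = cancelˡ {u = uPart i} {u′ = Δ +ᵥ uPart j}
            (U.sub-closed (uPart∈ i) (U.+-closed Up (uPart∈ j))) (wPart∈ i) (wPart∈ j)
            (λ t → begin
              uPart i t +F wPart i t      ≈⟨ p≋ i t ⟨
              p i t                       ≈⟨ +-identityʳ _ ⟨
              p i t +F 0#                 ≈⟨ +-congˡ (-‿inverseˡ (p j t)) ⟨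
              p i t +F (- p j t +F p j t) ≈⟨ +-assoc _ _ _ ⟨
              Δ t +F p j t                ≈⟨ +-congˡ (p≋ j t) ⟩
              Δ t +F (uPart j t +F wPart j t) ≈⟨ +-assoc _ _ _ ⟨
              (Δ +ᵥ uPart j) t +F wPart j t ∎)
            where open ≈R

-- Scalars, proportional vectors and hyperplanes.

module FiniteGeometry (F : Field) {q : ℕ} (order : HasOrder F q) where
  open Field F hiding (zero)
  open Geometry F
  open LinearAlgebra F
  open Finite order
  open import Algebra.Properties.CommutativeSemigroup +-commutativeSemigroup using (interchange)
  open import Algebra.Properties.Ring ring using ([y-z]x≈yx-zx)
  open import Algebra.Properties.AbelianGroup +-abelianGroup
    using (⁻¹-∙-comm; x∙y⁻¹≈ε⇒x≈y; ⁻¹-anti-homo‿-; //-rightDividesʳ; xyx⁻¹≈y)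
  open import Algebra.Solver.CommutativeMonoid +-commutativeMonoid using (solve; _⊕_; _⊜_)
  import Relation.Binary.Reasoning.Setoid setoid as ≈R

  [x+y]-[x+z] : ∀ x y z → (x +F y) - (x +F z) ≈ y - z
  [x+y]-[x+z] x y z = begin
    (x +F y) - (x +F z)       ≈⟨ +-congˡ (⁻¹-∙-comm x z) ⟨
    (x +F y) +F (- x - z)     ≈⟨ interchange _ _ _ _ ⟩
    (x - x) +F (y - z)        ≈⟨ +-congʳ (-‿inverseʳ x) ⟩
    0# +F (y - z)             ≈⟨ +-identityˡ _ ⟩
    y - z                     ∎
    where open ≈R

  [x+y]+[z-y] : ∀ x y z → (x +F y) +F (z - y) ≈ x +F z
  [x+y]+[z-y] x y z = trans
    (interchange _ _ _ _)
    (trans (+-congˡ (-‿inverseʳ y)) (+-identityʳ _))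

  subspace : ∀ {n k} (W : Subspace n k) → IsVectorSubspace ⟦ W ⟧
  subspace W = Span-isVectorSubspace (basis W)

  cancel-scalar : ∀ {n} {A : VSet n} → IsVectorSubspace A → ∀ c {v} → ¬ (c ≈ 0#) → A (c · v) → A v
  cancel-scalar A-sub c {v} c≉0 Acv = let d , cd≈1 = inverse c c≉0 in
    IsVectorSubspace.resp A-sub
      (λ i → trans (sym (*-assoc d c (v i))) (trans (*-congʳ (trans (*-comm d c) cd≈1)) (*-identityˡ _)))
      (IsVectorSubspace.·-closed A-sub d Acv)

  scalar≈0 : ∀ {n} {A : VSet n} → IsVectorSubspace A → ∀ c {v} → ¬ A v → A (c · v) → c ≈ 0#
  scalar≈0 A-sub c ¬Av Acv with c ≈? 0#
  ... | yes c≈0 = c≈0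
  ... | no  c≉0 = contradiction (cancel-scalar A-sub c c≉0 Acv) ¬Av

  Proportional-sym : ∀ {n} {u v : Vec n} → ¬ IsZero v → Proportional u v → Proportional v u
  Proportional-sym {u = u} {v} v≢0 (c , v≋cu) with c ≈? 0#
  ... | yes c≈0 = contradiction (λ i → trans (v≋cu i) (trans (*-congʳ c≈0) (zeroˡ _))) v≢0
  ... | no  c≉0 = let d , cd≈1 = inverse c c≉0 in d , λ i → sym (begin
    d *F v i        ≈⟨ *-congˡ (v≋cu i) ⟩
    d *F (c *F u i) ≈⟨ *-assoc d c (u i) ⟨
    (d *F c) *F u i ≈⟨ *-congʳ (trans (*-comm d c) cd≈1) ⟩
    1# *F u i       ≈⟨ *-identityˡ _ ⟩
    u i             ∎)
    where open ≈R

  basis-nonzero : ∀ {n k} (W : Subspace n k) j → ¬ IsZero (basis W j)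
  basis-nonzero W j Wⱼ≋0 = 0≉1 (trans
    (sym (independent W (unit j) (≋-trans (≋-sym (basis≋lc-unit (basis W) j)) Wⱼ≋0) j))
    (unit-diagonal j))
    where
    unit-diagonal : ∀ {k} (j : Fin k) → unit j j ≈ 1#
    unit-diagonal zero    = refl
    unit-diagonal (suc j) = unit-diagonal j

  line⟨_⟩ : ∀ {n} (v : Vec n) → ¬ IsZero v → Subspace n 1
  line⟨ v ⟩ v≢0 = record
    { basis = λ _ → v
    ; independent = λ { c cv≋0 zero → scalar≈0 0-sub (c zero) v≢0 (λ i → trans (sym (+-identityʳ _)) (cv≋0 i)) }
    }
    where
    0-sub : IsVectorSubspace IsZero
    0-sub = record
      { resp     = λ u≋v u≋0 i → trans (sym (u≋v i)) (u≋0 i)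
      ; 0-closed = λ _ → refl
      ; +-closed = λ u≋0 v≋0 i → trans (+-cong (u≋0 i) (v≋0 i)) (+-identityˡ _)
      ; ·-closed = λ c v≋0 i → trans (*-congˡ (v≋0 i)) (zeroʳ c)
      }

  -- The line through `a` is a complement of `W`: a multiple of `a` inside `W` has scalar zero.
  hyperplane-decompose : ∀ {n k d} (W : Subspace n k) (g : Fin d → Vec n) → k + 1 ≡ d → ⟦ W ⟧ ⊆ Span g →
    ∀ {a} → Span g a → ¬ ⟦ W ⟧ a → ∀ v → Span g v →
    Σ _ λ w → Σ Carrier λ c → ⟦ W ⟧ w × v ≋ (w +ᵥ (c · a))
  hyperplane-decompose W g eq W⊆g {a} a∈g a∉W v v∈g =
    let w , _ , w∈W , (c , l≋) , v≋ = Complements.decompose W (line⟨ a ⟩ a≢0) g eq W⊆g line⊆g disjoint v v∈g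
    in w , c zero , w∈W , λ i → trans (v≋ i) (+-congˡ (trans (l≋ i) (+-identityʳ _)))
    where
    module W = IsVectorSubspace (subspace W)
    a≢0 : ¬ IsZero a
    a≢0 a≋0 = a∉W (W.resp (≋-sym a≋0) W.0-closed)
    line⊆g : ⟦ line⟨ a ⟩ a≢0 ⟧ ⊆ Span g
    line⊆g = IsVectorSubspace.Span⊆ (Span-isVectorSubspace g) (λ _ → a∈g)
    disjoint : Disjoint ⟦ W ⟧ ⟦ line⟨ a ⟩ a≢0 ⟧
    disjoint v v∈W (c , v≋) i = trans (v≋ca i) (trans (*-congʳ c≈0) (zeroˡ _))
      where
      v≋ca : v ≋ (c zero · a)
      v≋ca i = trans (v≋ i) (+-identityʳ _)
      c≈0 = scalar≈0 (subspace W) (c zero) a∉W (W.resp v≋ca v∈W)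

  -- Spreads: their number of elements and the cosets of each element.

  module Spread {n d k M} (Σ∞ : Subspace n d) (S : Fin M → Subspace n k) (spread : IsSpread Σ∞ S)
    (k+k≡d : k + k ≡ d) (i₀ : Fin k) (z x₀ : Fin M) (x₀≢z : x₀ ≢ z) where

    private
      N = q ^ k
      S⊆Σ∞ = proj₁ spread
      S-disjoint = proj₁ (proj₂ spread)
      cover = proj₂ (proj₂ spread)
      module Σ∞ = IsVectorSubspace (subspace Σ∞)
      module S j = IsVectorSubspace (subspace (S j))
      module Sz = S z

    S-unique : ∀ {v} j j′ → ¬ IsZero v → ⟦ S j ⟧ v → ⟦ S j′ ⟧ v → j ≡ j′
    S-unique j j′ v≢0 vj vj′ with j Finₚ.≟ j′
    ... | yes eq = eq
    ... | no j≢j′ = contradiction (S-disjoint j j′ j≢j′ _ vj vj′) v≢0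

    ⊆⇒≡ : ∀ j j′ → ⟦ S j ⟧ ⊆ ⟦ S j′ ⟧ → j ≡ j′
    ⊆⇒≡ j j′ Sj⊆ = S-unique j j′ (basis-nonzero (S j) i₀) bj (Sj⊆ _ bj)
      where bj = basis∈Span (basis (S j)) i₀

    private
      w : Vec n
      w = basis (S x₀) i₀
      w∈ : ⟦ S x₀ ⟧ w
      w∈ = basis∈Span (basis (S x₀)) i₀
      w∉Sz : ¬ ⟦ S z ⟧ w
      w∉Sz w∈z = x₀≢z (S-unique x₀ z (basis-nonzero (S x₀) i₀) w∈ w∈z)
      zVec : Fin N → Vec n
      zVec c = lc (decode c) (basis (S z))
      zVec∈ : ∀ c → ⟦ S z ⟧ (zVec c)
      zVec∈ c = decode c , λ _ → refl
      at : Fin N → Vec n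
      at c = w +ᵥ zVec c
      at∉Sz : ∀ c → ¬ ⟦ S z ⟧ (at c)
      at∉Sz c at∈z = w∉Sz (Sz.resp (λ i → //-rightDividesʳ (zVec c i) (w i)) (Sz.sub-closed at∈z (zVec∈ c)))
      at≢0 : ∀ c → ¬ IsZero (at c)
      at≢0 c at≋0 = at∉Sz c (Sz.resp (≋-sym at≋0) Sz.0-closed)
      abstract
        covered : ∀ c → Σ (Fin M) λ j → ⟦ S j ⟧ (at c)
        covered c = cover _ (Σ∞.+-closed (S⊆Σ∞ x₀ _ w∈) (S⊆Σ∞ z _ (zVec∈ c)))

    -- The coset w + S z meets each S x, x ≢ z, exactly once and misses S z.
    σ : Fin (suc N) → Fin M
    σ zero    = z
    σ (suc c) = proj₁ (covered c)

    σ-suc≢z : ∀ c → σ (suc c) ≢ z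
    σ-suc≢z c eq = at∉Sz c (≡.subst (λ j → ⟦ S j ⟧ (at c)) eq (proj₂ (covered c)))

    -- Two points of the coset `w + S z` in the same spread element differ by a vector of that
    -- element and of `S z`, hence by zero.
    σ-injective : ∀ j j′ → σ j ≡ σ j′ → j ≡ j′
    σ-injective zero    zero     _  = ≡.refl
    σ-injective zero    (suc c)  eq = contradiction (≡.sym eq) (σ-suc≢z c)
    σ-injective (suc c) zero     eq = contradiction eq (σ-suc≢z c)
    σ-injective (suc c) (suc c′) eq = ≡.cong suc (≡.trans (≡.sym (code-decode {k} c))
      (≡.trans (code-cong (coordinates-unique (independent (S z)) (-≋0⇒≋ difference≋0))) (code-decode {k} c′)))
      where
      j = σ (suc c)
      difference≋0 : IsZero (zVec c -ᵥ zVec c′)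
      difference≋0 = S-disjoint j z (σ-suc≢z c) _
        (S.resp j (λ i → [x+y]-[x+z] (w i) (zVec c i) (zVec c′ i))
          (S.sub-closed j (proj₂ (covered c)) (≡.subst (λ j → ⟦ S j ⟧ (at c′)) (≡.sym eq) (proj₂ (covered c′)))))
        (Sz.sub-closed (zVec∈ c) (zVec∈ c′))

    -- Σ∞ is the direct sum of `S x` and `S z`. If `w = s + t` accordingly, then `s = w - t` is a
    -- point of the coset in `S x`; this is why `c` codes the negated coordinates of `t`.
    σ-surjective : ∀ x → Σ (Fin (suc N)) λ j → σ j ≡ x
    σ-surjective x with x Finₚ.≟ z
    ... | yes x≡z = zero , ≡.sym x≡z
    ... | no  x≢z = let s , t , s∈ , (a , t≋) , w≋ = decompose w (S⊆Σ∞ x₀ w w∈)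
                        c = code (λ j → 0# - a j)
                    in suc c , S-unique _ x (at≢0 c) (proj₂ (covered c))
                         (S.resp x (λ i → sym (trans
                           (+-cong (trans (w≋ i) (+-congˡ (t≋ i)))
                             (trans (sym (lc-congˡ (basis (S z)) (decode-code (λ j → 0# - a j)) i))
                               (trans (lc-‿- (λ _ → 0#) a (basis (S z)) i) (trans (+-congʳ (lc-0 (basis (S z)) i)) (+-identityˡ _)))))
                           (//-rightDividesʳ _ _))) s∈)
      where open Complements (S x) (S z) (basis Σ∞) k+k≡d (S⊆Σ∞ x) (S⊆Σ∞ z) (S-disjoint x z x≢z)

    private
      -- Any spread element different from `S (σ j)` is a complement of it in Σ∞, and its
      -- coordinates then number the cosets.
      other : Fin (suc N) → Fin M
      other zero    = x₀
      other (suc c) = z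
      other≢ : ∀ j → σ j ≢ other j
      other≢ zero    eq = x₀≢z (≡.sym eq)
      other≢ (suc c) eq = σ-suc≢z c eq
      module C j = Complements (S (σ j)) (S (other j)) (basis Σ∞) k+k≡d (S⊆Σ∞ _) (S⊆Σ∞ _)
                     (S-disjoint _ _ (other≢ j))

    abstract
      -- For a fixed affine point a, the points a + u with equal `label j u` are those on one line
      -- through the infinite point `σ j`. The two laws below characterise the label, whose
      -- construction stays opaque.
      label : Fin (suc N) → Σ (Vec n) ⟦ Σ∞ ⟧ → Fin N
      label j = C.cosetLabel j proj₁ proj₂

      label≡⇒∈ : ∀ j u v → label j u ≡ label j v → ⟦ S (σ j) ⟧ (proj₁ u -ᵥ proj₁ v)
      label≡⇒∈ j = C.label≡⇒coset j proj₁ proj₂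

      ∈⇒label≡ : ∀ j u v → ⟦ S (σ j) ⟧ (proj₁ u -ᵥ proj₁ v) → label j u ≡ label j v
      ∈⇒label≡ j = C.coset⇒label≡ j proj₁ proj₂

    -- The difference of the two vectors is nonzero, so it lies in exactly one spread element; that
    -- element is the direction of the joining line.
    joined : ∀ u v → ¬ (proj₁ u ≋ proj₁ v) →
      Σ (Fin (suc N)) λ j → label j u ≡ label j v × (∀ j′ → label j′ u ≡ label j′ v → j′ ≡ j)
    joined u v u≢v =
      let x , ∈x  = cover _ (Σ∞.sub-closed (proj₂ u) (proj₂ v))
          j , σj≡x = σ-surjective x
          ∈σj     = ≡.subst (λ x → ⟦ S x ⟧ _) (≡.sym σj≡x) ∈x
      in j , ∈⇒label≡ j u v ∈σj , λ j′ eq →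
           σ-injective j′ j (S-unique _ _ (u≢v ∘ -≋0⇒≋) (label≡⇒∈ j′ u v eq) ∈σj)

  -- From n³ affine points with tangents to a unital of the plane.

  module UnitalCriterion {m M n : ℕ} (Σ∞ : Subspace (4 * m + 1) (4 * m)) (S : Fin M → Subspace (4 * m + 1) (2 * m))
    (spread : IsSpread Σ∞ S) (i₀ : Fin (2 * m)) (z x₀ : Fin M) (x₀≢z : x₀ ≢ z)
    {K : ℕ} (N≡n² : q ^ (2 * m) ≡ n * n) (K≡n³ : K ≡ n * (n * n))
    {a : Vec (4 * m + 1)} (a∉ : ¬ ⟦ Σ∞ ⟧ a) (d : Fin K → Vec (4 * m + 1)) (d∈ : ∀ p → ⟦ Σ∞ ⟧ (d p))
    (tangent : ∀ p → Σ (Fin M) λ x → x ≢ z × (∀ r → ⟦ S x ⟧ (d r -ᵥ d p) → r ≡ p))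
    where
    open Plane m M Σ∞ S
    private
      2m+2m≡4m : ∀ m → 2 * m + 2 * m ≡ 4 * m
      2m+2m≡4m = solve-∀
      module Σ∞ = IsVectorSubspace (subspace Σ∞)
      module S j = IsVectorSubspace (subspace (S j))
    open Spread Σ∞ S spread (2m+2m≡4m m) i₀ z x₀ x₀≢z

    α : Fin K → Vec (4 * m + 1)
    α p = a +ᵥ d p

    private
      D : Fin K → Σ (Vec (4 * m + 1)) ⟦ Σ∞ ⟧
      D p = d p , d∈ p

      affine-∉ : ∀ {s} → ⟦ Σ∞ ⟧ s → ¬ ⟦ Σ∞ ⟧ (a +ᵥ s)
      affine-∉ s∈ a+s∈ = a∉ (Σ∞.resp (λ i → //-rightDividesʳ _ _) (Σ∞.sub-closed a+s∈ s∈))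

      ∉⇒≢0 : ∀ {v} → ¬ ⟦ Σ∞ ⟧ v → ¬ IsZero v
      ∉⇒≢0 v∉ v≋0 = v∉ (Σ∞.resp (≋-sym v≋0) Σ∞.0-closed)

      -- Distinctness is part of tangency: equal vectors differ by zero, which lies in every `S x`.
      d-injective : ∀ p r → d p ≋ d r → p ≡ r
      d-injective p r eq = let x , _ , alone = tangent r in
        alone p (S.resp x (≋-sym (≋⇒-≋0 eq)) (S.0-closed x))

      α-injective : ∀ p r → Proportional (α p) (α r) → p ≡ r
      α-injective p r (c , αr≋) = ≡.sym (d-injective r p λ i → begin
          d r i                    ≈⟨ xyx⁻¹≈y (a i) (d r i) ⟨
          α r i - a i              ≈⟨ +-congʳ (trans (αr≋ i) (trans (*-congʳ c≈1) (*-identityˡ _))) ⟩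
          α p i - a i              ≈⟨ xyx⁻¹≈y (a i) (d p i) ⟩
          d p i                    ∎)
        where
        open ≈R
        rearrange : ∀ c a d e → a +F e ≈ c *F (a +F d) → (c *F d) - e ≈ (1# - c) *F a
        rearrange c a d e eq = begin
          (c *F d) - e                         ≈⟨ [x+y]-[x+z] (c *F a) (c *F d) e ⟨
          (c *F a +F c *F d) - (c *F a +F e)   ≈⟨ +-congʳ (trans (sym (distribˡ c a d)) (sym eq)) ⟩
          (a +F e) - (c *F a +F e)             ≈⟨ +-cong (+-comm a e) (-‿cong (+-comm (c *F a) e)) ⟩
          (e +F a) - (e +F c *F a)             ≈⟨ [x+y]-[x+z] e a (c *F a) ⟩
          a - c *F a                           ≈⟨ +-congʳ (*-identityˡ a) ⟨
          1# *F a - c *F a                     ≈⟨ [y-z]x≈yx-zx a 1# c ⟨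
          (1# - c) *F a                        ∎
        -- Proportionality puts `(1# - c) · a` into Σ∞, while `a` is outside it.
        c≈1 : c ≈ 1#
        c≈1 = sym (x∙y⁻¹≈ε⇒x≈y 1# c (scalar≈0 (subspace Σ∞) (1# - c) a∉
          (Σ∞.resp (λ i → rearrange c (a i) (d p i) (d r i) (αr≋ i))
            (Σ∞.sub-closed (Σ∞.·-closed c (d∈ p)) (d∈ r)))))

      tangentAt : ∀ p {x} → x ≢ z → (∀ r → ⟦ S x ⟧ (d r -ᵥ d p) → r ≡ p) →
        (Σ _ λ j → σ j ≡ x) → Σ _ λ c → ∀ r → label (suc c) (D r) ≡ label (suc c) (D p) → r ≡ p
      tangentAt p x≢z alone (zero  , ≡.refl) = contradiction ≡.refl x≢z
      tangentAt p x≢z alone (suc c , ≡.refl) = c , λ r eq → alone r (label≡⇒∈ (suc c) (D r) (D p) eq)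

      tangentClass : ∀ p → Σ _ λ c → ∀ r → label (suc c) (D r) ≡ label (suc c) (D p) → r ≡ p
      tangentClass p = let x , x≢z , alone = tangent p in tangentAt p x≢z alone (σ-surjective x)

      module Count = BruenThas {n = n} N≡n² K≡n³ (λ j p → label j (D p))
        (λ p r p≢r → joined (D p) (D r) (p≢r ∘ d-injective p r)) tangentClass

    -- σ j is the point at infinity of L, and c the coset of S (σ j) that L − a cuts out on Σ∞.
    Trace : Subspace (4 * m + 1) (2 * m + 1) → Set
    Trace L = Σ (Fin (suc (q ^ (2 * m)))) λ j → Σ (Fin (q ^ (2 * m))) λ c →
      (∀ p → label j (D p) ≡ c → ⟦ L ⟧ (α p)) × (∀ p → ⟦ L ⟧ (α p) → label j (D p) ≡ c) ×
      (∀ x → ⟦ S x ⟧ ⊆ ⟦ L ⟧ → x ≡ σ j) × (⟦ S (σ j) ⟧ ⊆ ⟦ L ⟧)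

    affineTrace : ∀ L → IsLine (ord L) → Trace L
    affineTrace L (L⊈ , x , L∩≐Sx) = trace L L⊈ x L∩≐Sx (σ-surjective x)
      where
      trace : ∀ L → ¬ (⟦ L ⟧ ⊆ ⟦ Σ∞ ⟧) → ∀ x → (⟦ L ⟧ ∩ ⟦ Σ∞ ⟧) ≐ ⟦ S x ⟧ →
        (Σ (Fin (suc (q ^ (2 * m)))) λ j → σ j ≡ x) → Trace L
      trace L L⊈ x (L∩⊆Sx , Sx⊆L∩) (j , ≡.refl) = j , label j (s , s∈) ,
        (λ p eq → L.resp (λ i → [x+y]+[z-y] (a i) (s i) (d p i))
          (L.+-closed as∈ (proj₁ (Sx⊆L∩ _ (label≡⇒∈ j (D p) (s , s∈) eq))))) ,
        (λ p α∈ → ∈⇒label≡ j (D p) (s , s∈) (L∩⊆Sx _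
          ( L.resp (λ i → [x+y]-[x+z] (a i) (d p i) (s i)) (L.sub-closed α∈ as∈)
          , Σ∞.sub-closed (d∈ p) s∈))) ,
        (λ y Sy⊆L → ⊆⇒≡ y (σ j) (λ v v∈ → L∩⊆Sx v (Sy⊆L v v∈ , proj₁ spread y v v∈))) ,
        (λ v v∈ → proj₁ (Sx⊆L∩ v v∈))
        where
        module L = IsVectorSubspace (subspace L)
        basisPoint : Σ _ λ i → ¬ ⟦ Σ∞ ⟧ (basis L i)
        basisPoint = Finₚ.¬∀⟶∃¬ _ _ (λ i → basis L i ∈Span? basis Σ∞) (λ all → L⊈ (Σ∞.Span⊆ all))
        ℓ = basis L (proj₁ basisPoint)
        -- Here `ℓ = t + e · a`, with `e` nonzero because `ℓ` is affine. Scaling by the inverse of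
        -- `e` gives a point `a + s` of `L`, so `α p` is on `L` exactly when `d p - s` lies in
        -- `S (σ j)`.
        split = hyperplane-decompose Σ∞ unit ≡.refl (λ v _ → _ , lc-unit v) {a} (_ , lc-unit a) a∉ ℓ (_ , lc-unit ℓ)
        t = proj₁ split
        e = proj₁ (proj₂ split)
        t∈ = proj₁ (proj₂ (proj₂ split))
        ℓ≋ = proj₂ (proj₂ (proj₂ split))
        e≉0 : ¬ (e ≈ 0#)
        e≉0 e≈0 = proj₂ basisPoint (Σ∞.resp (λ i → sym (trans (ℓ≋ i)
          (trans (+-congˡ (trans (*-congʳ e≈0) (zeroˡ _))) (+-identityʳ _)))) t∈)
        e⁻¹ = proj₁ (inverse e e≉0)
        s = e⁻¹ · t
        s∈ : ⟦ Σ∞ ⟧ s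
        s∈ = Σ∞.·-closed e⁻¹ t∈
        as∈ : ⟦ L ⟧ (a +ᵥ s)
        as∈ = L.resp (λ i → trans (*-congˡ (ℓ≋ i)) (trans (distribˡ _ _ _) (trans (+-comm _ _)
                (+-congʳ (trans (sym (*-assoc _ _ _)) (trans (*-congʳ (trans (*-comm _ _) (proj₂ (inverse e e≉0)))) (*-identityˡ _)))))))
              (L.·-closed e⁻¹ (basis∈Span (basis L) (proj₁ basisPoint)))

    module _ (U : PSet)
      (U-aff   : ∀ p → U (aff (α p)))
      (U-aff⁻¹ : ∀ v → U (aff v) → ¬ ⟦ Σ∞ ⟧ v × Σ (Fin K) λ p → Proportional (α p) v)
      (U-inf   : U (inf z))
      (U-inf⁻¹ : ∀ x → U (inf x) → x ≡ z)
      where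

      private
        α-isPoint : ∀ p → IsPoint (aff (α p))
        α-isPoint p = ∉⇒≢0 (affine-∉ (d∈ p)) , affine-∉ (d∈ p)

        hasSize-affine : ∀ {A : PSet} {Q : Fin K → Set} {k} → Enumeration Q k →
          (∀ p → Q p → A (aff (α p))) →
          (∀ v → A (aff v) → Σ (Fin K) λ p → Q p × Proportional v (α p)) →
          (∀ x → ¬ A (inf x)) → HasSize A k
        hasSize-affine (f , f-sound , f-inj , f-complete) sound complete noInf =
          aff ∘ α ∘ f ,
          (λ i → α-isPoint (f i) , sound _ (f-sound i)) ,
          (λ i j eq → f-inj i j (α-injective _ _ eq)) ,
          λ { (aff v) _ Av → let p , Qp , v∼ = complete v Av ; i , fi≡p = f-complete p Qp
                             in i , ≡.subst (λ p → Proportional v (α p)) (≡.sym fi≡p) v∼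
            ; (inf x) _ Ax → contradiction Ax (noInf x) }

        hasSize-∞ : ∀ {A : PSet} {Q : Fin K → Set} {k} → Enumeration Q k →
          (∀ p → Q p → A (aff (α p))) →
          (∀ v → A (aff v) → Σ (Fin K) λ p → Q p × Proportional v (α p)) →
          A (inf z) → (∀ x → A (inf x) → x ≡ z) → HasSize A (suc k)
        hasSize-∞ {A} {k = k} (f , f-sound , f-inj , f-complete) sound complete Az onlyz =
          g , g-sound , g-inj , g-complete
          where
          g : Fin (suc k) → Point
          g zero    = inf z
          g (suc i) = aff (α (f i))
          g-sound : ∀ i → IsPoint (g i) × A (g i)
          g-sound zero    = tt , Az
          g-sound (suc i) = α-isPoint (f i) , sound _ (f-sound i)
          g-inj : ∀ i j → g i ≈ₚ g j → i ≡ j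
          g-inj zero    zero    _  = ≡.refl
          g-inj (suc i) (suc j) eq = ≡.cong suc (f-inj i j (α-injective _ _ eq))
          g-complete : ∀ x → IsPoint x → A x → Σ (Fin (suc k)) λ i → x ≈ₚ g i
          g-complete (aff v) _ Av = let p , Qp , v∼ = complete v Av ; i , fi≡p = f-complete p Qp
                                    in suc i , ≡.subst (λ p → Proportional v (α p)) (≡.sym fi≡p) v∼
          g-complete (inf x) _ Ax = zero , onlyz x Ax

        resize : ∀ {A : PSet} {k k′} → k ≡ k′ → HasSize A k → HasSize A k′
        resize {A} = ≡.subst (HasSize A)

        U-affine : ∀ v → U (aff v) → Σ (Fin K) λ p → Proportional v (α p)
        U-affine v Uv = let v∉ , p , α∼v = U-aff⁻¹ v Uv in p , Proportional-sym (∉⇒≢0 v∉) α∼v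

        sizeOnLine : ∀ L → IsLine L →
          HasSize (λ x → U x × (x on L)) 1 ⊎ HasSize (λ x → U x × (x on L)) (n + 1)
        sizeOnLine lineS _ = inj₁
          ( (λ _ → inf z) , (λ _ → tt , U-inf , tt) , (λ { zero zero _ → ≡.refl })
          , λ { (aff v) _ (_ , ()) ; (inf x) _ (Ux , _) → zero , U-inf⁻¹ x Ux })
        sizeOnLine (ord L) isLine = let j , c , trace = affineTrace L isLine in byClass j c trace
          where
          complete : ∀ j {c} → (∀ p → ⟦ L ⟧ (α p) → label j (D p) ≡ c) →
            ∀ v → U (aff v) × ⟦ L ⟧ v → Σ (Fin K) λ p → label j (D p) ≡ c × Proportional v (α p)
          complete j L⇒label v (Uv , Lv) = let p , e , α≋ev = U-affine v Uv in
            p , L⇒label p (IsVectorSubspace.resp (subspace L) (≋-sym α≋ev) (IsVectorSubspace.·-closed (subspace L) e Lv)) , e , α≋ev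
          byClass : ∀ j c →
            (∀ p → label j (D p) ≡ c → ⟦ L ⟧ (α p)) × (∀ p → ⟦ L ⟧ (α p) → label j (D p) ≡ c) ×
            (∀ x → ⟦ S x ⟧ ⊆ ⟦ L ⟧ → x ≡ σ j) × (⟦ S (σ j) ⟧ ⊆ ⟦ L ⟧) →
            HasSize (λ x → U x × (x on ord L)) 1 ⊎ HasSize (λ x → U x × (x on ord L)) (n + 1)
          -- The class size n omits `z`, which is on the line and restores n + 1.
          byClass zero c (label⇒L , L⇒label , _ , S⊆L) = inj₂ (resize
            (≡.trans (≡.cong suc (Count.size-zero c)) (ℕₚ.+-comm 1 n))
            (hasSize-∞ (enumerate (λ p → label zero (D p) Finₚ.≟ c))
              (λ p eq → U-aff p , label⇒L p eq) (complete zero L⇒label)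
              (U-inf , S⊆L) (λ x → U-inf⁻¹ x ∘ proj₁)))
          -- The only infinite point of such a line is `σ (suc x)`, which is not `z`, so the affine
          -- count is already the full size.
          byClass (suc x) c (label⇒L , L⇒label , atInfinity , _) =
            [ (λ eq → inj₁ (resize eq sized)) , (λ eq → inj₂ (resize (≡.trans eq (ℕₚ.+-comm 1 n)) sized)) ]
              (Count.size-suc x c)
            where
            sized : HasSize (λ y → U y × (y on ord L)) (Count.size (suc x) c)
            sized = hasSize-affine (enumerate (λ p → label (suc x) (D p) Finₚ.≟ c))
              (λ p eq → U-aff p , label⇒L p eq) (complete (suc x) L⇒label)
              (λ y → λ { (Uy , Sy⊆L) → σ-suc≢z x (≡.trans (≡.sym (atInfinity y Sy⊆L)) (U-inf⁻¹ y Uy)) })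

      isUnital : IsUnital n U
      isUnital =
        (λ { (aff v) Uv → let v∉ = proj₁ (U-aff⁻¹ v Uv) in ∉⇒≢0 v∉ , v∉ ; (inf x) _ → tt }) ,
        resize (≡.trans (≡.cong suc K≡n³) (size-lemma n))
          -- `Fin 1` serves as the predicate that always holds: all `K` affine points are taken, and
          -- `z` is the additional one.
          (hasSize-∞ {Q = λ _ → Fin 1} {k = K} (id , (λ _ → zero) , (λ _ _ eq → eq) , (λ p _ → p , ≡.refl))
            (λ p _ → U-aff p) (λ v Uv → let p , v∼ = U-affine v Uv in p , zero , v∼)
            U-inf U-inf⁻¹) ,
        sizeOnLine
        where
        size-lemma : ∀ n → suc (n * (n * n)) ≡ n * (n * (n * 1)) + 1
        size-lemma = solve-∀

  -- The points of B* obtained from the egg, and their tangents.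

  module EggUnital
    (m : ℕ) (1≤m : 1 ≤ m)
    (E : Fin (q ^ (2 * m) + 1) → Subspace (4 * m) m)
    (∞ : Fin (q ^ (2 * m) + 1))
    (T : Fin (q ^ (2 * m) + 1) → Subspace (4 * m) (3 * m)) (tangents : IsTangentFamily q m E T)
    (Γ : Subspace (4 * m) (3 * m + 1)) (T∞⊆Γ : ⟦ T ∞ ⟧ ⊆ ⟦ Γ ⟧)
    (Σ∞ : Subspace (4 * m + 1) (4 * m)) (φ : Matrix (4 * m + 1) (4 * m))
    (φ-injective : ∀ v → ⟦ Γ ⟧ v → IsZero (apply φ v) → IsZero v)
    (φΓ∩Σ∞ : (image φ ⟦ Γ ⟧ ∩ ⟦ Σ∞ ⟧) ≐ image φ ⟦ T ∞ ⟧)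
    (M : ℕ) (S : Fin M → Subspace (4 * m + 1) (2 * m)) (spread : IsSpread Σ∞ S)
    (z : Fin M) (V : Subspace (4 * m + 1) m) (V⊆Sz : ⟦ V ⟧ ⊆ ⟦ S z ⟧)
    (I⊆I[V] : ∀ i → i ≢ ∞ → Σ (Fin M) λ x → x ≢ z ×
       (image φ (EggSetup.I-E q m E T ∞ Γ i) ≐ (⟨ S x , V ⟩ ∩ image φ ⟦ T ∞ ⟧)))
    where
    open EggSetup q m E T ∞ Γ using (B-E; I-E)
    open Plane m M Σ∞ S

    private
      module E i = IsVectorSubspace (subspace (E i))
      module T i = IsVectorSubspace (subspace (T i))
      module Γ = IsVectorSubspace (subspace Γ)
      module Σ∞ = IsVectorSubspace (subspace Σ∞)
      module V = IsVectorSubspace (subspace V)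
      module S j = IsVectorSubspace (subspace (S j))

      n N : ℕ
      n = q ^ m
      N = q ^ (2 * m)

      N≡n² : N ≡ n * n
      N≡n² = ≡.trans (≡.cong (λ k → q ^ (m + k)) (ℕₚ.+-identityʳ m)) (ℕₚ.^-distribˡ-+-* q m m)

      K≡n³ : N * n ≡ n * (n * n)
      K≡n³ = ≡.trans (≡.cong (_* n) N≡n²) (ℕₚ.*-assoc n n n)

      φ-‿- : ∀ u v → apply φ (u -ᵥ v) ≋ (apply φ u -ᵥ apply φ v)
      φ-‿- u v = lc-‿- u v _

      φ-· : ∀ c v → apply φ (c · v) ≋ (c · apply φ v)
      φ-· c v = lc-* c v _

      φ-cong : ∀ {u v} → u ≋ v → apply φ u ≋ apply φ v
      φ-cong u≋v = lc-congˡ _ u≋v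

      φ-injectiveΓ : ∀ {u v} → ⟦ Γ ⟧ u → ⟦ Γ ⟧ v → apply φ u ≋ apply φ v → u ≋ v
      φ-injectiveΓ {u} {v} u∈ v∈ eq = -≋0⇒≋ (φ-injective _ (Γ.sub-closed u∈ v∈)
        (≋-trans (φ-‿- u v) (≋⇒-≋0 eq)))

      γ-exists : Σ (Fin (3 * m + 1)) λ j → ¬ ⟦ T ∞ ⟧ (basis Γ j)
      γ-exists = ∃∉Span (basis Γ) (basis (T ∞)) (ℕₚ.+-comm (3 * m) 1) (independent Γ)

      γ : Vec (4 * m)
      γ = basis Γ (proj₁ γ-exists)
      γ∉T∞ : ¬ ⟦ T ∞ ⟧ γ
      γ∉T∞ = proj₂ γ-exists
      γ∈Γ : ⟦ Γ ⟧ γ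
      γ∈Γ = basis∈Span (basis Γ) (proj₁ γ-exists)

      other : Enumeration (_≢ ∞) N
      other = allBut (ℕₚ.+-comm N 1) ∞

      idx : Fin N → Fin (N + 1)
      idx = proj₁ other
      idx≢∞ : ∀ c → idx c ≢ ∞
      idx≢∞ = proj₁ (proj₂ other)

      -- The tangent space at E∞ misses the egg element, and the dimensions m and 3m fill the whole
      -- space. The component of `γ` in the egg element differs from `γ` by a vector of `T ∞`, so it
      -- stays in Γ'.
      γ-parts : ∀ c → (⟦ E (idx c) ⟧ ⊕ˢ ⟦ T ∞ ⟧) γ
      γ-parts c = Complements.decompose (E (idx c)) (T ∞) unit ≡.refl
        (λ v _ → v , lc-unit v) (λ v _ → v , lc-unit v)
        (λ v vE vT → proj₂ (tangents ∞) (idx c) (idx≢∞ c) v vT vE) γ (γ , lc-unit γ)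

      -- P c spans E ∩ Γ', normalised to lie in γ + E∞*
      P t : Fin N → Vec (4 * m)
      P c = proj₁ (γ-parts c)
      t c = proj₁ (proj₂ (γ-parts c))

      P∈E : ∀ c → ⟦ E (idx c) ⟧ (P c)
      P∈E c = proj₁ (proj₂ (proj₂ (γ-parts c)))
      t∈T∞ : ∀ c → ⟦ T ∞ ⟧ (t c)
      t∈T∞ c = proj₁ (proj₂ (proj₂ (proj₂ (γ-parts c))))
      γ≋P+t : ∀ c → γ ≋ (P c +ᵥ t c)
      γ≋P+t c = proj₂ (proj₂ (proj₂ (proj₂ (γ-parts c))))

      P≋γ-t : ∀ c → P c ≋ (γ -ᵥ t c)
      P≋γ-t c i = sym (trans (+-congʳ (γ≋P+t c i)) (//-rightDividesʳ (t c i) (P c i)))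

      P∈Γ : ∀ c → ⟦ Γ ⟧ (P c)
      P∈Γ c = Γ.resp (≋-sym (P≋γ-t c)) (Γ.sub-closed γ∈Γ (T∞⊆Γ _ (t∈T∞ c)))

      P≢0 : ∀ c → ¬ IsZero (P c)
      P≢0 c P≋0 = γ∉T∞ (T.resp ∞ (λ i → sym (trans (γ≋P+t c i) (trans (+-congʳ (P≋0 i)) (+-identityˡ _)))) (t∈T∞ c))

      -- Subtracting the multiple of `P c` with the same `γ`-coefficient leaves a vector of `T ∞` in
      -- the egg element, which is zero.
      P-unique : ∀ c Q → ⟦ E (idx c) ⟧ Q → ⟦ Γ ⟧ Q → Proportional (P c) Q
      P-unique c Q Q∈E Q∈Γ =
        let s , e , s∈ , Q≋ = hyperplane-decompose (T ∞) (basis Γ) ≡.refl T∞⊆Γ γ∈Γ γ∉T∞ Q Q∈Γ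
        in e , -≋0⇒≋ (proj₂ (tangents ∞) (idx c) (idx≢∞ c) _
              (T.resp ∞ (λ i → rearrange (s i) e (P c i) (t c i) (Q i) (trans (Q≋ i) (+-congˡ (*-congˡ (γ≋P+t c i)))))
                (T.+-closed ∞ s∈ (T.·-closed ∞ e (t∈T∞ c))))
              (E.sub-closed (idx c) Q∈E (E.·-closed (idx c) e (P∈E c))))
        where
        rearrange : ∀ s e p t Q → Q ≈ s +F e *F (p +F t) → s +F e *F t ≈ Q - e *F p
        rearrange s e p t Q eq = sym (trans
          (+-congʳ (trans eq (trans (+-congˡ (distribˡ e p t))
            (solve 3 (λ x y w → (x ⊕ (y ⊕ w)) ⊜ ((x ⊕ w) ⊕ y)) refl s (e *F p) (e *F t)))))
          (//-rightDividesʳ (e *F p) _))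

      a : Vec (4 * m + 1)
      a = apply φ γ

      a∉Σ∞ : ¬ ⟦ Σ∞ ⟧ a
      a∉Σ∞ a∈ = let u , u∈ , φu≋a = proj₁ φΓ∩Σ∞ a ((γ , γ∈Γ , λ _ → refl) , a∈)
                 in γ∉T∞ (T.resp ∞ (φ-injectiveΓ (T∞⊆Γ u u∈) γ∈Γ φu≋a) u∈)

      φT∞⊆Σ∞ : ∀ {u} → ⟦ T ∞ ⟧ u → ⟦ Σ∞ ⟧ (apply φ u)
      φT∞⊆Σ∞ {u} u∈ = proj₂ (proj₂ φΓ∩Σ∞ _ (u , u∈ , λ _ → refl))

      V⊆Σ∞ : ⟦ V ⟧ ⊆ ⟦ Σ∞ ⟧
      V⊆Σ∞ v v∈ = proj₁ spread z v (V⊆Sz v v∈)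

      vec : Fin n → Vec (4 * m + 1)
      vec w = lc (decode w) (basis V)
      vec∈ : ∀ w → ⟦ V ⟧ (vec w)
      vec∈ w = decode w , λ _ → refl

      shift : Fin N → Fin n → Vec (4 * m + 1)
      shift c w = vec w -ᵥ apply φ (t c)

      shift∈ : ∀ c w → ⟦ Σ∞ ⟧ (shift c w)
      shift∈ c w = Σ∞.sub-closed (V⊆Σ∞ _ (vec∈ w)) (φT∞⊆Σ∞ (t∈T∞ c))

      a+shift : ∀ c w → (a +ᵥ shift c w) ≋ (apply φ (P c) +ᵥ vec w)
      a+shift c w i = sym (trans (+-congʳ (trans (φ-cong (P≋γ-t c) i) (φ-‿- γ (t c) i)))
        (solve 3 (λ x y w → ((x ⊕ y) ⊕ w) ⊜ (x ⊕ (w ⊕ y))) refl _ _ _))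

      -- A second point on the line through S x would lie over a P c′ in the tangent space at E (idx c).
      shift-tangent : ∀ c w → Σ (Fin M) λ x → x ≢ z ×
        (∀ c′ w′ → ⟦ S x ⟧ (shift c′ w′ -ᵥ shift c w) → c′ ≡ c × w′ ≡ w)
      shift-tangent c w = x , x≢z , λ c′ w′ s∈ → alone c′ w′ s∈ (same-c c′ w′ s∈)
        where
        x = proj₁ (I⊆I[V] (idx c) (idx≢∞ c))
        x≢z = proj₁ (proj₂ (I⊆I[V] (idx c) (idx≢∞ c)))
        ⟨Sx,V⟩⊆I = proj₂ (proj₂ (proj₂ (I⊆I[V] (idx c) (idx≢∞ c))))
        same-c : ∀ c′ w′ → ⟦ S x ⟧ (shift c′ w′ -ᵥ shift c w) → c′ ≡ c
        same-c c′ w′ s∈ = proj₁ (proj₂ (proj₂ other)) c′ c (decidable-stable (idx c′ Finₚ.≟ idx c)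
          λ c′≢c → P≢0 c′ (proj₂ (tangents (idx c)) (idx c′) c′≢c _ Pc′∈T (P∈E c′)))
          where
          Δ : Vec (4 * m)
          Δ = t c -ᵥ t c′
          Δ∈ : ⟦ T ∞ ⟧ Δ
          Δ∈ = T.sub-closed ∞ (t∈T∞ c) (t∈T∞ c′)
          -- The V-parts of the two shifts are removed again, which writes `φ Δ` as a vector of
          -- `S x` plus a vector of `V`.
          φΔ≋ : apply φ Δ ≋ ((shift c′ w′ -ᵥ shift c w) +ᵥ (vec w -ᵥ vec w′))
          φΔ≋ i = trans (φ-‿- (t c) (t c′) i) (sym (eq (vec w′ i) (apply φ (t c′) i) (vec w i) (apply φ (t c) i)))
            where
            open ≈R
            eq : ∀ v′ f′ v f → ((v′ - f′) - (v - f)) +F (v - v′) ≈ f - f′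
            eq v′ f′ v f = begin
              ((v′ - f′) - (v - f)) +F (v - v′)
                ≈⟨ +-congʳ (+-congˡ (⁻¹-anti-homo‿- v f)) ⟩
              ((v′ - f′) +F (f - v)) +F (v - v′)
                ≈⟨ solve 6 (λ a b c d e g → (((a ⊕ b) ⊕ (c ⊕ d)) ⊕ (e ⊕ g)) ⊜ ((c ⊕ b) ⊕ ((a ⊕ g) ⊕ (e ⊕ d)))) refl _ _ _ _ _ _ ⟩
              (f - f′) +F ((v′ - v′) +F (v - v))
                ≈⟨ +-congˡ (trans (+-cong (-‿inverseʳ v′) (-‿inverseʳ v)) (+-identityˡ _)) ⟩
              (f - f′) +F 0#
                ≈⟨ +-identityʳ _ ⟩
              f - f′ ∎
          preimage : image φ (I-E (idx c)) (apply φ Δ)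
          preimage = ⟨Sx,V⟩⊆I _
            ( Span-++⁺ (basis (S x)) (basis V) _ (_ , _ , s∈ , V.sub-closed (vec∈ w) (vec∈ w′) , φΔ≋)
            , (Δ , Δ∈ , λ _ → refl))
          Δ∈T : ⟦ T (idx c) ⟧ Δ
          Δ∈T = let u , (u∈T , u∈T∞) , φu≋ = preimage
                in T.resp (idx c) (φ-injectiveΓ (T∞⊆Γ u u∈T∞) (T∞⊆Γ _ Δ∈) φu≋) u∈T
          -- Both points are normalised by the same `γ`, so `P c′ = P c + Δ`.
          Pc′∈T : ⟦ T (idx c) ⟧ (P c′)
          Pc′∈T = T.resp (idx c)
            (λ i → trans (+-congʳ (P≋γ-t c i)) (trans
              (trans (solve 4 (λ g b t d → ((g ⊕ b) ⊕ (t ⊕ d)) ⊜ ((g ⊕ d) ⊕ (t ⊕ b))) refl _ _ _ _)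
                (trans (+-congˡ (-‿inverseʳ (t c i))) (+-identityʳ _)))
              (sym (P≋γ-t c′ i))))
            (T.+-closed (idx c) (proj₁ (tangents (idx c)) _ (P∈E c)) Δ∈T)

        alone : ∀ c′ w′ → ⟦ S x ⟧ (shift c′ w′ -ᵥ shift c w) → c′ ≡ c → c′ ≡ c × w′ ≡ w
        -- Over the same `P c` the `φ`-terms cancel, and `vec w′ - vec w` lies both in `S x` and in
        -- `S z`.
        alone c′ w′ s∈ ≡.refl = ≡.refl , ≡.trans (≡.sym (code-decode {m} w′)) (≡.trans
                (code-cong (coordinates-unique (independent V) (-≋0⇒≋
                  (proj₁ (proj₂ spread) x z x≢z _
                    (S.resp x (λ i → trans
                       (+-cong (+-comm _ _) (-‿cong (+-comm _ _))) ([x+y]-[x+z] _ (vec w′ i) (vec w i))) s∈)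
                    (V⊆Sz _ (V.sub-closed (vec∈ w′) (vec∈ w)))))))
                (code-decode {m} w))

      split : Fin (N * n) → Fin N × Fin n
      split = remQuot {N} n

      d : Fin (N * n) → Vec (4 * m + 1)
      d p = shift (proj₁ (split p)) (proj₂ (split p))

      d-tangent : ∀ p → Σ (Fin M) λ x → x ≢ z × (∀ r → ⟦ S x ⟧ (d r -ᵥ d p) → r ≡ p)
      d-tangent p = let x , x≢z , alone = shift-tangent (proj₁ (split p)) (proj₂ (split p)) in
        x , x≢z , λ r s∈ → let c≡ , w≡ = alone (proj₁ (split r)) (proj₂ (split r)) s∈ in
          ≡.trans (≡.sym (Finₚ.combine-remQuot {N} n r))
            (≡.trans (≡.cong₂ combine c≡ w≡) (Finₚ.combine-remQuot {N} n p))

      U : PSet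
      U = B* B-E φ V z

      U-aff : ∀ p → U (aff (a +ᵥ d p))
      U-aff p = (λ v≋0 → v∉ (Σ∞.resp (≋-sym v≋0) Σ∞.0-closed)) , v∉ ,
        P c , (P≢0 c , idx c , idx≢∞ c , P∈E c , P∈Γ c) ,
        (1# ∷ decode w) , λ i → trans (a+shift c w i) (+-congʳ (sym (*-identityˡ _)))
        where
        c = proj₁ (split p)
        w = proj₂ (split p)
        v∉ : ¬ ⟦ Σ∞ ⟧ (a +ᵥ d p)
        v∉ v∈ = a∉Σ∞ (Σ∞.resp (λ i → //-rightDividesʳ _ _) (Σ∞.sub-closed v∈ (shift∈ c w)))

      -- The coefficient `h` of `φ (P c)` in `v` is nonzero, since otherwise `v` would lie in `V`
      -- and so in Σ∞. Dividing by `h` yields the normalised representative, and `w` codes its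
      -- V-part.
      pointOn : ∀ c {v Q} → ¬ ⟦ Σ∞ ⟧ v → ∀ e → v ≋ lc e (apply φ Q ∷ basis V) → ∀ f → Q ≋ (f · P c) →
        Σ (Fin (N * n)) λ p → Proportional (a +ᵥ d p) v
      pointOn c {v} {Q} v∉ e v≋ f Q≋ =
        combine c w , h , λ i → sym (trans
                (*-congˡ (trans (reflexive (≡.cong (λ cw → (a +ᵥ shift (proj₁ cw) (proj₂ cw)) i) (Finₚ.remQuot-combine c w)))
                  (a+shift c w i)))
                (trans (distribˡ _ _ _) (trans (+-congˡ (hw i)) (sym (v≋′ i)))))
        where
        h = e zero *F f
        tail : Fin m → Carrier
        tail = e ∘ suc
        v≋′ : v ≋ ((h · apply φ (P c)) +ᵥ lc tail (basis V))
        v≋′ i = trans (v≋ i) (+-congʳ (trans (*-congˡ (trans (φ-cong Q≋ i) (φ-· f (P c) i))) (sym (*-assoc _ _ _))))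
        h≉0 : ¬ (h ≈ 0#)
        h≉0 h≈0 = v∉ (Σ∞.resp (λ i → sym (trans (v≋′ i) (trans (+-congʳ (trans (*-congʳ h≈0) (zeroˡ _))) (+-identityˡ _))))
                    (V⊆Σ∞ _ (tail , λ _ → refl)))
        h⁻¹ = proj₁ (inverse h h≉0)
        w : Fin n
        w = code (λ j → h⁻¹ *F tail j)
        hw : (h · vec w) ≋ lc tail (basis V)
        hw i = trans (*-congˡ (trans (sym (lc-congˡ (basis V) (decode-code (λ j → h⁻¹ *F tail j)) i)) (lc-* h⁻¹ tail (basis V) i)))
          (trans (sym (*-assoc _ _ _)) (trans (*-congʳ (proj₂ (inverse h h≉0))) (*-identityˡ _)))

      U-aff⁻¹ : ∀ v → U (aff v) → ¬ ⟦ Σ∞ ⟧ v × Σ (Fin (N * n)) λ p → Proportional (a +ᵥ d p) v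
      U-aff⁻¹ v (_ , v∉ , Q , (_ , i , i≢∞ , Q∈E , Q∈Γ) , e , v≋) =
        let c , idx-c≡i = proj₂ (proj₂ (proj₂ other)) i i≢∞
            f , Q≋ = P-unique c Q (≡.subst (λ i → ⟦ E i ⟧ Q) (≡.sym idx-c≡i) Q∈E) Q∈Γ
        in v∉ , pointOn c v∉ e v≋ f Q≋

      x₀ : Σ (Fin M) λ x → x ≢ z
      x₀ = let x , x≢z , _ = I⊆I[V] (idx c₀) (idx≢∞ c₀) in x , x≢z
        where
        c₀ : Fin N
        -- The code of the zero vector shows that `Fin N` is inhabited, hence that some egg element
        -- besides E∞ supplies a spread element besides `S z`.
        c₀ = code {2 * m} (λ _ → 0#)

      i₀ : ∀ {m} → 1 ≤ m → Fin (2 * m)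
      i₀ (s≤s _) = zero

    B*-isUnital : IsUnital n U
    B*-isUnital = UnitalCriterion.isUnital Σ∞ S spread (i₀ 1≤m) z (proj₁ x₀) (proj₂ x₀) N≡n² K≡n³
      a∉Σ∞ d (λ p → shift∈ _ _) d-tangent U U-aff U-aff⁻¹ ≡.refl (λ _ eq → eq)

theorem3 : (q m : ℕ) → IsPrimePower q → 1 ≤ m →
    (F : Field) → HasOrder F q →
    let open Geometry F in
    (E : Fin (q ^ (2 * m) + 1) → Subspace (4 * m) m) → IsEgg q m E →
    (∞ : Fin (q ^ (2 * m) + 1)) →
    (T : Fin (q ^ (2 * m) + 1) → Subspace (4 * m) (3 * m)) → IsTangentFamily q m E T →
    (Γ : Subspace (4 * m) (3 * m + 1)) → ⟦ T ∞ ⟧ ⊆ ⟦ Γ ⟧ →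
    EggSetup.MinimalBlocking q m E T ∞ Γ →
    (Σ∞ : Subspace (4 * m + 1) (4 * m)) →
    (φ : Matrix (4 * m + 1) (4 * m)) →
    (∀ v → ⟦ Γ ⟧ v → IsZero (apply φ v) → IsZero v) →
    (image φ ⟦ Γ ⟧ ∩ ⟦ Σ∞ ⟧) ≐ image φ ⟦ T ∞ ⟧ →
    (M : ℕ) (S : Fin M → Subspace (4 * m + 1) (2 * m)) → IsSpread Σ∞ S →
    (z : Fin M) (V : Subspace (4 * m + 1) m) →
    ⟦ V ⟧ ⊆ ⟦ S z ⟧ → Disjoint ⟦ V ⟧ (image φ ⟦ T ∞ ⟧) →
    (∀ i → i ≢ ∞ → Σ (Fin M) λ x → x ≢ z ×
    (image φ (EggSetup.I-E q m E T ∞ Γ i) ≐ (⟨ S x , V ⟩ ∩ image φ ⟦ T ∞ ⟧))) →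
    (∀ x → x ≢ z → Σ (Fin (q ^ (2 * m) + 1)) λ i → i ≢ ∞ ×
    (image φ (EggSetup.I-E q m E T ∞ Γ i) ≐ (⟨ S x , V ⟩ ∩ image φ ⟦ T ∞ ⟧))) →
    Plane.IsUnital m M Σ∞ S (q ^ m)
    (Plane.B* m M Σ∞ S (EggSetup.B-E q m E T ∞ Γ) φ V z)
theorem3 q m _ 1≤m F order E _ ∞ T tangents Γ T∞⊆Γ _ Σ∞ φ φ-injective φΓ∩Σ∞ M S spread z V V⊆Sz V-T∞ I⊆I[V] _ =
  FiniteGeometry.EggUnital.B*-isUnital F order m 1≤m E ∞ T tangents Γ T∞⊆Γ Σ∞ φ φ-injective φΓ∩Σ∞ M S spread z V V⊆Sz I⊆I[V]
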